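{- Let $T$ be a tree of diameter $d$ and metric dimension $k$, where $k\geq 2$. Then \[ |V(T)| \leq \begin{cases} \frac{1}{8}(kd+4)(d+2) & \text{if } d \text{ is even},\\ \frac{1}{8}(kd-k+8)(d+1) & \text{if } d \text{ is odd}.\end{cases}\] Equality holds for even $d$ if and only if $T$ is isomorphic to $HS_{d,k}$, and for odd $d$ if and only if $T$ is isomorphic to $HS_{d,k,a}$ for some integer $a$ with $0<a<k$.
   Context: Graphs are finite and simple. A resolving set of a connected graph $G$ is a set $R$ of vertices such that for every pair $u\neq v$ of vertices there is $x\in R$ with $d(x,u)\neq d(x,v)$; the metric dimension is the minimum size of a resolving set. For $r\in\mathbb{N}$, $L_r$ is the rooted tree obtained from a path $v_0,v_1,\ldots,v_r$ rooted at $v_0$ by attaching, for each $i=1,\ldots,r-1$, a path of length $r-i$ to $v_i$ (one end of the attached path identified with $v_i$). $P_r^*$ denotes a path of length $r$ rooted at one of its end vertices. For even $d$, the hairy spider $HS_{d,k}$ is the tree obtained from $k$ disjoint copies of $L_{d/2}$ and one path $P_{d/2}^*$ by identifying all their roots into a single vertex. For odd $d\geq 3$ and integer $0\leq a\leq k$, $HS_{d,k,a}$ is the tree obtained from $k$ disjoint copies of $L_{(d-1)/2}$, two copies of $P^*_{(d-1)/2}$, and a path on two vertices $u,w$, by identifying the roots of $a$ copies of $L_{(d-1)/2}$ and of one copy of $P^*_{(d-1)/2}$ with $u$, and the roots of the remaining $k-a$ copies of $L_{(d-1)/2}$ and of the other copy of $P^*_{(d-1)/2}$ with $w$. -}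

module Defs where

open import Data.Nat using (ℕ; zero; suc; _+_; _*_; _∸_; _≤_; _<_)
open import Data.Fin using (Fin; inject₁; fromℕ; toℕ) renaming (zero to fzero; suc to fsuc)
open import Data.Fin.Subset using (Subset; _∈_; ∣_∣)
open import Data.Bool using (Bool; true; false)
open import Data.Product using (Σ; ∃; ∃-syntax; _×_; _,_)
open import Data.Sum using (_⊎_; inj₁; inj₂)
open import Data.Empty using (⊥)
open import Relation.Nullary using (¬_)
open import Relation.Binary.PropositionalEquality using (_≡_; _≢_)
open import Function.Bundles using (_↔_; _⇔_; Inverse)

record Graph (V : Set) : Set₁ where
  field
    Adj    : V → V → Set
    sym    : ∀ {x y} → Adj x y → Adj y x
    irrefl : ∀ {x} → ¬ Adj x x
open Graph public

data Walk {V : Set} (G : Graph V) : V → V → ℕ → Set where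
  nil  : ∀ {x} → Walk G x x 0
  cons : ∀ {x y z m} → Adj G x y → Walk G y z m → Walk G x z (suc m)

Dist : {V : Set} → Graph V → V → V → ℕ → Set
Dist G x y m = Walk G x y m × (∀ m' → Walk G x y m' → m ≤ m')

Connected : {V : Set} → Graph V → Set
Connected G = ∀ x y → ∃[ m ] Walk G x y m

record Cycle {V : Set} (G : Graph V) : Set where
  field
    len   : ℕ
    vtx   : Fin (suc (suc (suc len))) → V
    inj   : ∀ i j → vtx i ≡ vtx j → i ≡ j
    step  : ∀ (i : Fin (suc (suc len))) → Adj G (vtx (inject₁ i)) (vtx (fsuc i))
    close : Adj G (vtx (fromℕ (suc (suc len)))) (vtx fzero)

IsTree : {V : Set} → Graph V → Set
IsTree G = Connected G × ¬ Cycle G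

Diameter : {V : Set} → Graph V → ℕ → Set
Diameter G d = (∃[ u ] ∃[ v ] Dist G u v d) × (∀ u v m → Dist G u v m → m ≤ d)

Resolving : {n : ℕ} → Graph (Fin n) → Subset n → Set
Resolving {n} G R = ∀ (u v : Fin n) → u ≢ v →
  ∃[ x ] (x ∈ R × (∀ a b → Dist G x u a → Dist G x v b → a ≢ b))

MetricDim : {n : ℕ} → Graph (Fin n) → ℕ → Set
MetricDim {n} G k = (∃[ R ] (Resolving G R × ∣ R ∣ ≡ k))
                  × (∀ R → Resolving G R → k ≤ ∣ R ∣)

Iso : {V W : Set} → Graph V → Graph W → Set
Iso {V} {W} G H = Σ (V ↔ W) λ f →
  ∀ x y → Adj G x y ⇔ Adj H (Inverse.to f x) (Inverse.to f y)

-- Hairy spiders.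
-- A copy of L_r with root removed has vertices (i , j) with 1 ≤ i ≤ r,
-- 0 ≤ j ≤ r - i: (i , 0) is the spine vertex v_i and (i , j) the j-th
-- vertex of the path of length r - i attached to v_i.
-- Edges: v_0–(1,0), (i,0)–(i+1,0), (i,j)–(i,j+1).
-- P*_r minus its root: vertices p_i, 1 ≤ i ≤ r, edges v_0–p_1, p_i–p_{i+1}.

data HSEvenV (k r : ℕ) : Set where
  root  : HSEvenV k r
  leg   : (c : Fin k) (i j : ℕ) → 1 ≤ i → i + j ≤ r → HSEvenV k r
  spine : (i : ℕ) → 1 ≤ i → i ≤ r → HSEvenV k r

data HSEvenE (k r : ℕ) : HSEvenV k r → HSEvenV k r → Set where
  root-leg    : ∀ {c p q} → HSEvenE k r root (leg c 1 0 p q)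
  leg-down    : ∀ {c i p q p' q'} →
                HSEvenE k r (leg c i 0 p q) (leg c (suc i) 0 p' q')
  leg-hair    : ∀ {c i j p q p' q'} →
                HSEvenE k r (leg c i j p q) (leg c i (suc j) p' q')
  root-spine  : ∀ {p q} → HSEvenE k r root (spine 1 p q)
  spine-step  : ∀ {i p q p' q'} → HSEvenE k r (spine i p q) (spine (suc i) p' q')

HSEvenE-irrefl : ∀ {k r x} → ¬ HSEvenE k r x x
HSEvenE-irrefl ()

HS-even : (k r : ℕ) → Graph (HSEvenV k r)
HS-even k r = record
  { Adj    = λ x y → HSEvenE k r x y ⊎ HSEvenE k r y x
  ; sym    = λ { (inj₁ e) → inj₂ e ; (inj₂ e) → inj₁ e }
  ; irrefl = λ { (inj₁ e) → HSEvenE-irrefl e ; (inj₂ e) → HSEvenE-irrefl e }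
  }

-- odd diameter d = 2r+1 : HS_{2r+1,k,a}
-- centre true = u, centre false = w; copies c with toℕ c < a hang at u,
-- the others at w; spine b is the copy of P*_r hanging at centre b.
data HSOddV (k r : ℕ) : Set where
  centre : Bool → HSOddV k r
  leg    : (c : Fin k) (i j : ℕ) → 1 ≤ i → i + j ≤ r → HSOddV k r
  spine  : Bool → (i : ℕ) → 1 ≤ i → i ≤ r → HSOddV k r

data HSOddE (k r a : ℕ) : HSOddV k r → HSOddV k r → Set where
  u-w         : HSOddE k r a (centre true) (centre false)
  u-leg       : ∀ {c p q} → toℕ c < a →
                HSOddE k r a (centre true) (leg c 1 0 p q)
  w-leg       : ∀ {c p q} → a ≤ toℕ c →
                HSOddE k r a (centre false) (leg c 1 0 p q)
  leg-down    : ∀ {c i p q p' q'} →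
                HSOddE k r a (leg c i 0 p q) (leg c (suc i) 0 p' q')
  leg-hair    : ∀ {c i j p q p' q'} →
                HSOddE k r a (leg c i j p q) (leg c i (suc j) p' q')
  root-spine  : ∀ {b p q} → HSOddE k r a (centre b) (spine b 1 p q)
  spine-step  : ∀ {b i p q p' q'} →
                HSOddE k r a (spine b i p q) (spine b (suc i) p' q')

HSOddE-irrefl : ∀ {k r a x} → ¬ HSOddE k r a x x
HSOddE-irrefl ()

HS-odd : (k r a : ℕ) → Graph (HSOddV k r)
HS-odd k r a = record
  { Adj    = λ x y → HSOddE k r a x y ⊎ HSOddE k r a y x
  ; sym    = λ { (inj₁ e) → inj₂ e ; (inj₂ e) → inj₁ e }
  ; irrefl = λ { (inj₁ e) → HSOddE-irrefl e ; (inj₂ e) → HSOddE-irrefl e }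
  }

{-# OPTIONS --safe #-}

-- Root T at the middle vertex c of a diametral path (d = 2r), so that all
-- depths are at most r. Two children of the same vertex without elements of a
-- resolving set R below them have equal distances to all of R, so every vertex
-- has at most one such child. Hence y is determined by its lowest ancestor v
-- that is c or has an element of R below it, and the number j of steps from v
-- down to y; and if v ≠ c, by an x ∈ R below v together with the depth i ≥ 1 of
-- v. As i + j ≤ r, these data are exactly a vertex of the hairy spider. For
-- d = 2r+1 the same is done for the two rooted trees left when the central edge
-- is cut. Equality makes this injective labelling bijective, and then it
-- commutes with taking parents.
module Submission where

open import Defs
open import Data.Nat
open import Data.Nat.Properties
open import Data.Nat.Induction using (<-rec)
open import Data.Nat.Solver using (module +-*-Solver)
open import Data.Bool using (Bool; true; false; T; not)
open import Data.Empty using (⊥)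
open import Data.Fin using (Fin; toℕ; fromℕ; fromℕ<; inject₁; punchOut; splitAt; _↑ˡ_; _↑ʳ_) renaming (zero to fzero; suc to fsuc)
import Data.Fin.Properties as Fin
open import Data.Fin.Permutation using (↔⇒≡)
open import Data.Fin.Subset using (Subset; _∈_; ∣_∣)
open import Data.Maybe using (Maybe; just; nothing)
open import Data.Product using (Σ; _×_; _,_; proj₁; proj₂; ∃-syntax)
open import Data.Product.Function.NonDependent.Propositional using (_×-↔_)
open import Data.Sum as Sum using (_⊎_; inj₁; inj₂)
open import Data.Sum.Function.Propositional using (_⊎-↔_)
open import Data.Unit using (⊤; tt)
open import Data.Vec using ([]; _∷_; here; there)
open import Function.Bundles using (_⇔_; _↔_; mk⇔; mk↔ₛ′; Inverse; Equivalence; Injection)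
open import Function.Construct.Composition using (_⇔-∘_)
open import Function.Construct.Identity using (⇔-id)
open import Function.Construct.Symmetry using (⇔-sym)
open import Function.Properties.Inverse using (↔-refl; ↔-sym; ↔-trans; ↔⇒↣)
open import Relation.Binary.Definitions using (DecidableEquality)
open import Relation.Binary.PropositionalEquality
  using (_≡_; _≢_; refl; trans; cong; subst; subst₂) renaming (sym to ≡-sym)
open import Relation.Nullary using (¬_; Dec; yes; no; does; contradiction)
open import Relation.Nullary.Decidable using (dec-true; dec-false)
open +-*-Solver using (solve; con; _:*_; _:+_; _:=_)

-- Adjacency is an arbitrary relation without a decision procedure, so shortest walks cannot be
-- searched for. Depths and parents are therefore read off reduced walks to the root, whose vertex
-- sequences acyclicity makes unique. The existence of a distance is available only under double
-- negation (`dist-nonempty`); this suffices because it is used only towards decidable conclusions,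
-- equalities of vertices and inequalities of numbers. The label of a vertex above R depends on the
-- choice of one element of R below it, and a vertex and its parent may choose differently. Hence
-- the labelling need not respect parents in general, although it is always injective; only the
-- equality case forces the choices to agree. The strict inequalities 0 < a < k come from the
-- central edge: were R contained in one half, the end of the edge in the other half would be a
-- second R-free neighbour beside the first trunk vertex, and the two would be twins.

-- Walks, and uniqueness of reduced walks in acyclic graphs.

module _ {V : Set} {G : Graph V} where

  _⊕_ : ∀ {x y z m m'} → Walk G x y m → Walk G y z m' → Walk G x z (m + m')
  nil      ⊕ q = q
  cons e p ⊕ q = cons e (p ⊕ q)

  splitWalk : ∀ m {m' x y} → Walk G x y (m + m') → ∃[ z ] (Walk G x z m × Walk G z y m')
  splitWalk zero    p          = _ , nil , p
  splitWalk (suc m) (cons e p) with z , q , q' ← splitWalk m p = z , cons e q , q'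

  reverse : ∀ {x y m} → Walk G x y m → Walk G y x m
  reverse nil = nil
  reverse {m = suc m} (cons e p) =
    subst (Walk G _ _) (+-comm m 1) (reverse p ⊕ cons (Graph.sym G e) nil)

  -- The empty walk points at its own vertex. So the root becomes its own parent, and the no-return
  -- condition on a last edge only says that its two ends differ.
  next : ∀ {x y m} → Walk G x y m → V
  next {x = x} nil        = x
  next (cons {y = y} _ _) = y

  NonBacktracking : ∀ {x y m} → Walk G x y m → Set
  NonBacktracking nil                = ⊤
  NonBacktracking (cons {x = x} _ p) = next p ≢ x × NonBacktracking p

  ReducedWalk : V → V → Set
  ReducedWalk x y = ∃[ m ] Σ (Walk G x y m) NonBacktracking

  -- Once the tail is reduced, only the new first edge can backtrack, and then it cancels against
  -- the first edge of the tail.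
  reduce : DecidableEquality V → ∀ {x y m} → Walk G x y m → ReducedWalk x y
  reduce _≟_ nil = 0 , nil , tt
  reduce _≟_ (cons {x = x} e p) with reduce _≟_ p
  ... | m , q , nb with next q ≟ x
  ...   | no  ≢x = suc m , cons e q , ≢x , nb
  ...   | yes ≡x with q | nb
  ...     | nil      | _      = contradiction (subst (λ z → Adj G z _) (≡-sym ≡x) e) (irrefl G)
  ...     | cons _ t | _ , nt = _ , subst (λ z → Σ (Walk G z _ _) NonBacktracking) ≡x (t , nt)

  vertex : ∀ {x y m} → Walk G x y m → ℕ → V
  vertex {x = x} _ zero     = x
  vertex {x = x} nil (suc i) = x
  vertex (cons _ p) (suc i) = vertex p i

  vertex-step : ∀ {x y m} (p : Walk G x y m) {i} → i < m → Adj G (vertex p i) (vertex p (suc i))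
  vertex-step (cons e nil)        {zero}  _     = e
  vertex-step (cons e (cons _ _)) {zero}  _     = e
  vertex-step (cons e p)          {suc i} (s≤s h) = vertex-step p h

  vertex-last : ∀ {x y m} (p : Walk G x y m) → vertex p m ≡ y
  vertex-last nil        = refl
  vertex-last (cons _ p) = vertex-last p

  Simple : ∀ {x y m} → Walk G x y m → Set
  Simple {m = m} p = ∀ i j → i ≤ m → j ≤ m → vertex p i ≡ vertex p j → i ≡ j

  module _ (acyclic : ¬ Cycle G) where

    -- Meeting `x` at index 0 would be a loop and at index 1 an immediate return; from index 2 on,
    -- the edge from `x` to `z` and the initial piece of `p` close up to a cycle.
    simple-open : ∀ {x z y m} → Adj G x z → (p : Walk G z y m) → next p ≢ x → Simple p →
                  ∀ i → i ≤ m → vertex p i ≢ x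
    simple-open e p ≢x sp 0 i≤m eq = irrefl G (subst (λ v → Adj G v _) (≡-sym eq) e)
    simple-open e (cons _ nil)        ≢x sp 1 i≤m eq = ≢x eq
    simple-open e (cons _ (cons _ _)) ≢x sp 1 i≤m eq = ≢x eq
    simple-open {m = m} e p ≢x sp (suc (suc i)) i≤m eq = acyclic record
      { len   = i
      ; vtx   = λ j → vertex p (toℕ j)
      ; inj   = λ j j' q → Fin.toℕ-injective (sp _ _ (bound j) (bound j') q)
      ; step  = λ j → subst (λ t → Adj G (vertex p t) (vertex p (suc (toℕ j))))
                        (≡-sym (Fin.toℕ-inject₁ j))
                        (vertex-step p (<-≤-trans (Fin.toℕ<n j) i≤m))
      ; close = subst (λ v → Adj G v _)
                  (≡-sym (trans (cong (vertex p) (Fin.toℕ-fromℕ (suc (suc i)))) eq)) e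
      }
      where
      bound : (j : Fin (3 + i)) → toℕ j ≤ m
      bound j = ≤-trans (≤-pred (Fin.toℕ<n j)) i≤m

    reduced⇒simple : ∀ {x y m} (p : Walk G x y m) → NonBacktracking p → Simple p
    reduced⇒simple nil _ .0 .0 z≤n z≤n _ = refl
    reduced⇒simple (cons e p) nb zero zero _ _ _ = refl
    reduced⇒simple (cons e p) (≢x , nb) zero (suc j) _ (s≤s j≤m) eq =
      contradiction (≡-sym eq) (simple-open e p ≢x (reduced⇒simple p nb) j j≤m)
    reduced⇒simple (cons e p) (≢x , nb) (suc i) zero (s≤s i≤m) _ eq =
      contradiction eq (simple-open e p ≢x (reduced⇒simple p nb) i i≤m)
    reduced⇒simple (cons e p) (_ , nb) (suc i) (suc j) (s≤s i≤m) (s≤s j≤m) eq =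
      cong suc (reduced⇒simple p nb i j i≤m j≤m eq)

    reduced-closed : ∀ {x m} (p : Walk G x x m) → NonBacktracking p → m ≡ 0
    reduced-closed {m = m} p nb =
      reduced⇒simple p nb m 0 ≤-refl z≤n (vertex-last p)

    -- Reverse p edge by edge onto q: the result is a reduced closed walk.
    reduced-diverge : ∀ {x y m m'} (p : Walk G x y m) (q : Walk G x y m') →
                      NonBacktracking p → NonBacktracking q → next p ≢ next q → ⊥
    reduced-diverge nil nil _ _ ≢n = ≢n refl
    reduced-diverge nil q@(cons _ _) _ nq _ with () ← reduced-closed q nq
    reduced-diverge (cons e p) q (≢x , np) nq ≢n =
      reduced-diverge p (cons (Graph.sym G e) q) np ((λ eq → ≢n (≡-sym eq)) , nq) ≢x

    reduced-next-unique : DecidableEquality V →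
      ∀ {x y m m'} (p : Walk G x y m) (q : Walk G x y m') →
      NonBacktracking p → NonBacktracking q → next p ≡ next q
    reduced-next-unique _≟_ p q np nq with next p ≟ next q
    ... | yes eq = eq
    ... | no neq with () ← reduced-diverge p q np nq neq

    reduced-length-unique : DecidableEquality V →
      ∀ {x y m m'} (p : Walk G x y m) (q : Walk G x y m') →
      NonBacktracking p → NonBacktracking q → m ≡ m'
    reduced-length-unique _≟_ nil q _ nq = ≡-sym (reduced-closed q nq)
    reduced-length-unique _≟_ p@(cons _ _) nil np _ = reduced-closed p np
    reduced-length-unique _≟_ p@(cons _ p') q@(cons _ q') np nq
      with refl ← reduced-next-unique _≟_ p q np nq =
      cong suc (reduced-length-unique _≟_ p' q' (proj₂ np) (proj₂ nq))

  -- By strong induction on the length: a walk with no shorter competitor would realise the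
  -- distance.
  dist-nonempty : ∀ {x y m} → Walk G x y m → ¬ (∀ a → ¬ Dist G x y a)
  dist-nonempty {x} {y} {m} p noDist = <-rec (λ m → ¬ Walk G x y m) shorter m p
    where
    shorter : ∀ m → (∀ {m'} → m' < m → ¬ Walk G x y m') → ¬ Walk G x y m
    shorter m rec p = noDist m (p , λ m' q → ≮⇒≥ (λ m'<m → rec m'<m q))

  -- Expresses that `v` separates `x` from `w`, with lengths recorded, so that distances from `x`
  -- can be compared without being computed.
  Through : V → V → V → Set
  Through x w v = ∀ {m} → Walk G x w m → ∃[ m' ] (suc m' ≤ m × Walk G x v m')

-- Forests with levels, and descendants.

-- Roots are the elements of level 0, where the value of `parent` is unconstrained. The rooted tree,
-- the tree cut at its central edge and the set of labels are all instances, so they can be compared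
-- as forests.
record Forest (V : Set) : Set where
  field
    parent       : V → V
    level        : V → ℕ
    level-parent : ∀ {x l} → level x ≡ suc l → level (parent x) ≡ l

module Descent {V : Set} (F : Forest V) where
  open Forest F

  data Below (v : V) : V → Set where
    here : Below v v
    up   : ∀ {x l} → level x ≡ suc l → Below v (parent x) → Below v x

  below-level : ∀ {v x} → Below v x → level v ≤ level x
  below-level here     = ≤-refl
  below-level (up e b) =
    ≤-trans (below-level b) (≤-trans (≤-reflexive (level-parent e)) (≤-trans (n≤1+n _) (≤-reflexive (≡-sym e))))

  below-parent : ∀ {v x l} → level x ≡ suc l → v ≢ x → Below v x → Below v (parent x)
  below-parent _ v≢x here     = contradiction refl v≢x
  below-parent _ _   (up _ b) = b

  parent-below : ∀ {v x l} → level v ≡ suc l → Below v x → Below (parent v) x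
  parent-below e here      = up e here
  parent-below e (up e' b) = up e' (parent-below e b)

  ¬up-below : ∀ {v x l} → level x ≡ suc l → level v ≡ level x → ¬ Below v (parent x)
  ¬up-below e eq b =
    1+n≰n (≤-trans (≤-reflexive (trans (≡-sym e) (≡-sym eq)))
                   (≤-trans (below-level b) (≤-reflexive (level-parent e))))

  below-unique : ∀ {v v' x} → level v ≡ level v' → Below v x → Below v' x → v ≡ v'
  below-unique _  here     here     = refl
  below-unique eq here     (up e b) = contradiction b (¬up-below e (≡-sym eq))
  below-unique eq (up e b) here     = contradiction b (¬up-below e eq)
  below-unique eq (up _ b) (up _ b') = below-unique eq b b'

  below-invariant : ∀ {B : Set} (f : V → B) → (∀ {x l} → level x ≡ suc l → f (parent x) ≡ f x) →
                    ∀ {v x} → Below v x → f v ≡ f x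
  below-invariant f inv here     = refl
  below-invariant f inv (up e b) = trans (below-invariant f inv b) (inv e)

  below? : DecidableEquality V → ∀ v x → Dec (Below v x)
  below? _≟_ v x = go (level x) x refl
    where
    go : ∀ l x → level x ≡ l → Dec (Below v x)
    go l x e with v ≟ x
    go l       x e | yes refl = yes here
    go zero    x e | no v≢x   = no λ { here → v≢x refl
                                     ; (up e' _) → 0≢1+n (trans (≡-sym e) e') }
    go (suc l) x e | no v≢x with go l (parent x) (level-parent e)
    ... | yes b = yes (up e b)
    ... | no ¬b = no λ b → ¬b (below-parent e v≢x b)

-- Rooted trees: depths, subtrees and walks entering a subtree.

module RootedTree {n : ℕ} (T : Graph (Fin n)) (tree : IsTree T) (c : Fin n) where

  toRoot : ∀ x → ReducedWalk {G = T} x c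
  toRoot x = reduce Fin._≟_ (proj₂ (proj₁ tree x c))

  depth : Fin n → ℕ
  depth x = proj₁ (toRoot x)

  parent : Fin n → Fin n
  parent x = next (proj₁ (proj₂ (toRoot x)))

  reduced-depth : ∀ {x m} (p : Walk T x c m) → NonBacktracking p → depth x ≡ m
  reduced-depth {x} p nb = reduced-length-unique (proj₂ tree) Fin._≟_ _ p (proj₂ (proj₂ (toRoot x))) nb

  reduced-parent : ∀ {x m} (p : Walk T x c m) → NonBacktracking p → parent x ≡ next p
  reduced-parent {x} p nb = reduced-next-unique (proj₂ tree) Fin._≟_ _ p (proj₂ (proj₂ (toRoot x))) nb

  depth-root : depth c ≡ 0
  depth-root = reduced-depth nil tt

  depth-0 : ∀ {x} → depth x ≡ 0 → x ≡ c
  depth-0 {x} eq with 0 , nil , _ ← toRoot x = refl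

  depth-suc : ∀ {x l} → depth x ≡ suc l → Adj T x (parent x) × depth (parent x) ≡ l
  depth-suc {x} eq with suc m , cons e p , _ , nb ← toRoot x =
    e , trans (reduced-depth p nb) (suc-injective eq)

  forest : Forest (Fin n)
  forest = record { parent = parent ; level = depth ; level-parent = λ e → proj₂ (depth-suc e) }

  open Descent forest public

  ChildOf : Fin n → Fin n → Set
  ChildOf x y = depth y ≡ suc (depth x) × parent y ≡ x

  -- Either the reduced walk from `y` to the root starts towards `x`, or prefixing the edge from `x`
  -- to `y` keeps it reduced and so gives the walk of `x`.
  adjacent : ∀ {x y} → Adj T x y → ChildOf x y ⊎ ChildOf y x
  adjacent {x} {y} e = go _ (proj₂ (proj₂ (toRoot y)))
    where
    go : ∀ {m} (p : Walk T y c m) → NonBacktracking p → ChildOf x y ⊎ ChildOf y x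
    go p nb with next p Fin.≟ x
    ... | no ≢x = inj₂ (trans (reduced-depth (cons e p) (≢x , nb))
                              (cong suc (≡-sym (reduced-depth p nb)))
                       , reduced-parent (cons e p) (≢x , nb))
    go nil _ | yes refl = contradiction e (irrefl T)
    go p@(cons _ q) nb | yes refl =
      inj₁ (trans (reduced-depth p nb) (cong suc (≡-sym (reduced-depth q (proj₂ nb))))
           , reduced-parent p nb)

  walk-depth : ∀ {x y m} → Walk T x y m → depth y ≤ m + depth x
  walk-depth nil = ≤-refl
  walk-depth (cons {x} {y} {m = m} e p) = ≤-trans (walk-depth p)
    (≤-trans (+-monoʳ-≤ m (bound (adjacent e))) (≤-reflexive (+-suc m (depth x))))
    where
    bound : ChildOf x y ⊎ ChildOf y x → depth y ≤ suc (depth x)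
    bound (inj₁ (eq , _)) = ≤-reflexive eq
    bound (inj₂ (eq , _)) = ≤-trans (≤-trans (n≤1+n _) (≤-reflexive (≡-sym eq))) (n≤1+n _)

  -- The only edge leaving the subtree at `w` is the one to its parent; the walk is cut where it
  -- first enters the subtree.
  walk-enter : ∀ {w x y m} → ¬ Below w x → Below w y → Walk T x y m →
               ∃[ m₁ ] ∃[ m₂ ] (Walk T x (parent w) m₁ × Walk T w y m₂ × m₁ + suc m₂ ≡ m)
  walk-enter ¬x y nil = contradiction y ¬x
  walk-enter {w} ¬x y (cons {y = x'} e p) with below? Fin._≟_ w x'
  ... | no ¬x' with m₁ , m₂ , p₁ , p₂ , eq ← walk-enter ¬x' y p =
    suc m₁ , m₂ , cons e p₁ , p₂ , cong suc eq
  ... | yes x'b with adjacent e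
  ...   | inj₂ (d , refl) = contradiction (up d x'b) ¬x
  ...   | inj₁ (d , pe) with w Fin.≟ x'
  ...     | yes refl rewrite pe = 0 , _ , nil , p , refl
  ...     | no w≢x' = contradiction (subst (Below w) pe (below-parent d w≢x' x'b)) ¬x

  ¬below-parent : ∀ {w l} → depth w ≡ suc l → ¬ Below w (parent w)
  ¬below-parent e = ¬up-below e refl

  through-parent : ∀ {w x} → ¬ Below w x → Through {G = T} x w (parent w)
  through-parent ¬x p with m₁ , m₂ , p₁ , _ , refl ← walk-enter ¬x here p =
    m₁ , ≤-trans (≤-reflexive (+-comm 1 m₁)) (+-monoʳ-≤ m₁ (s≤s z≤n)) , p₁

  through-child : ∀ {w x l} → depth w ≡ suc l → Below w x → Through {G = T} x (parent w) w
  through-child e b p with m₁ , m₂ , _ , p₂ , refl ← walk-enter (¬below-parent e) b (reverse p) =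
    m₂ , m≤n+m _ m₁ , reverse p₂

-- Twins with respect to a resolving set.

module _ {n : ℕ} {T : Graph (Fin n)} (connected : Connected T)
         {R : Subset n} (resolving : Resolving T R) where

  -- A shortest walk from `x` to one of the two neighbours passes `v` before its end; one step from
  -- `v` then reaches the other neighbour no later. By symmetry the distances agree, so no element
  -- of `R` resolves the pair.
  twins : ∀ {v w₁ w₂} → Adj T v w₁ → Adj T v w₂ →
          (∀ {x} → x ∈ R → Through {G = T} x w₁ v) → (∀ {x} → x ∈ R → Through {G = T} x w₂ v) →
          w₁ ≡ w₂
  twins {v} {w₁} {w₂} e₁ e₂ t₁ t₂ with w₁ Fin.≟ w₂
  ... | yes eq = eq
  ... | no neq with x , x∈R , h ← resolving w₁ w₂ neq =
    contradiction (λ a D₁ → dist-nonempty (proj₂ (connected x w₂)) (λ b D₂ →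
      h a b D₁ D₂ (≤-antisym (closer e₁ (t₂ x∈R) D₁ D₂) (closer e₂ (t₁ x∈R) D₂ D₁))))
      (dist-nonempty (proj₂ (connected x w₁)))
    where
    closer : ∀ {x w w' a b} → Adj T v w → Through x w' v → Dist T x w a → Dist T x w' b → a ≤ b
    closer e t (_ , min) (p , _) with m' , le , q ← t p =
      ≤-trans (min _ (q ⊕ cons e nil)) (≤-trans (≤-reflexive (+-comm m' 1)) le)

-- Labels and their forest.

-- branch c i j encodes leg c (suc i) j, so that every i : ℕ is allowed.
data Label (B : Set) (k : ℕ) : Set where
  trunk  : B → ℕ → Label B k
  branch : Fin k → ℕ → ℕ → Label B k

module _ {B : Set} {k : ℕ} where

  height : Label B k → ℕ
  height (trunk b j)    = j
  height (branch c i j) = suc i + j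

  extend : Label B k → Label B k
  extend (trunk b j)    = trunk b (suc j)
  extend (branch c i j) = branch c i (suc j)

  extend-injective : ∀ {ℓ ℓ'} → extend ℓ ≡ extend ℓ' → ℓ ≡ ℓ'
  extend-injective {trunk _ _}    {trunk _ _}    refl = refl
  extend-injective {branch _ _ _} {branch _ _ _} refl = refl

  extend≢trunk : ∀ {b} ℓ → extend ℓ ≢ trunk b 0
  extend≢trunk (trunk _ _) ()
  extend≢trunk (branch _ _ _) ()

  extend≢branch : ∀ {c i} ℓ → extend ℓ ≢ branch c i 0
  extend≢branch (trunk _ _) ()
  extend≢branch (branch _ _ _) ()

  height-extend : ∀ ℓ → height (extend ℓ) ≡ suc (height ℓ)
  height-extend (trunk _ _)    = refl
  height-extend (branch _ i j) = cong suc (+-suc i j)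

  module _ (side : Fin k → B) where

    -- `side c` is the root at which leg `c` hangs. The value on `trunk b zero` is a default, as
    -- that label has height 0.
    parentLabel : Label B k → Label B k
    parentLabel (trunk b zero)          = trunk b zero
    parentLabel (trunk b (suc j))       = trunk b j
    parentLabel (branch c i (suc j))    = branch c i j
    parentLabel (branch c (suc i) zero) = branch c i zero
    parentLabel (branch c zero zero)    = trunk (side c) zero

    parentLabel-extend : ∀ ℓ → parentLabel (extend ℓ) ≡ ℓ
    parentLabel-extend (trunk _ _)    = refl
    parentLabel-extend (branch _ _ _) = refl

    height-parentLabel : ∀ {ℓ l} → height ℓ ≡ suc l → height (parentLabel ℓ) ≡ l
    height-parentLabel {trunk b (suc j)}       refl = refl
    height-parentLabel {branch c i (suc j)}    e    = trans (≡-sym (+-suc i j)) (suc-injective e)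
    height-parentLabel {branch c (suc i) zero} e    = suc-injective e
    height-parentLabel {branch c zero zero}    e    = suc-injective e

    labelForest : Forest (Label B k)
    labelForest = record { parent = parentLabel ; level = height ; level-parent = λ {ℓ} → height-parentLabel {ℓ} }

-- The third alternative joins any two distinct roots. It is void for a single root and is the
-- central edge when there are two, so one definition covers both parities.
Linked : {V : Set} → Forest V → V → V → Set
Linked F x y = (∃[ l ] (level y ≡ suc l × parent y ≡ x))
             ⊎ (∃[ l ] (level x ≡ suc l × parent x ≡ y))
             ⊎ (level x ≡ 0 × level y ≡ 0 × x ≢ y)
  where open Forest F

module _ {V W : Set} (F : Forest V) (F' : Forest W) (f : V → W)
         (f-injective : ∀ {x y} → f x ≡ f y → x ≡ y)
         (f-level : ∀ x → Forest.level F' (f x) ≡ Forest.level F x)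
         (f-parent : ∀ {x l} → Forest.level F x ≡ suc l → Forest.parent F' (f x) ≡ f (Forest.parent F x))
         where

  linked-cong : ∀ {x y} → Linked F x y ⇔ Linked F' (f x) (f y)
  linked-cong = mk⇔
    (λ { (inj₁ (l , e , p)) → inj₁ (l , trans (f-level _) e , trans (f-parent e) (cong f p))
       ; (inj₂ (inj₁ (l , e , p))) → inj₂ (inj₁ (l , trans (f-level _) e , trans (f-parent e) (cong f p)))
       ; (inj₂ (inj₂ (e , e' , ≢))) → inj₂ (inj₂ (trans (f-level _) e , trans (f-level _) e' , λ eq → ≢ (f-injective eq))) })
    (λ { (inj₁ (l , e , p)) → inj₁ (l , back e , f-injective (trans (≡-sym (f-parent (back e))) p))
       ; (inj₂ (inj₁ (l , e , p))) → inj₂ (inj₁ (l , back e , f-injective (trans (≡-sym (f-parent (back e))) p)))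
       ; (inj₂ (inj₂ (e , e' , ≢))) → inj₂ (inj₂ (back e , back e' , λ eq → ≢ (cong f eq))) })
    where
    back : ∀ {x l} → Forest.level F' (f x) ≡ l → Forest.level F x ≡ l
    back e = trans (≡-sym (f-level _)) e


-- Counting labels of bounded height.

Labels : Set → ℕ → ℕ → Set
Labels B k r = Σ (Label B k) λ ℓ → height ℓ ≤ r

≤-pair : {A : Set} {f : A → ℕ} {r : ℕ} {x y : Σ A λ a → f a ≤ r} → proj₁ x ≡ proj₁ y → x ≡ y
≤-pair {x = a , p} {.a , q} refl = cong (a ,_) (≤-irrelevant p q)

-- The triangular number r(r+1)/2, which is the number of vertices of L_r other than its root.
triangle : ℕ → ℕ
triangle zero    = 0
triangle (suc r) = suc r + triangle r

Triangle : ℕ → Set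
Triangle r = Σ (ℕ × ℕ) λ (i , j) → suc i + j ≤ r

initial↔Fin : ∀ r → (Σ ℕ λ j → j ≤ r) ↔ Fin (suc r)
initial↔Fin r = mk↔ₛ′ (λ (j , p) → fromℕ< (s≤s p)) (λ i → toℕ i , Fin.toℕ≤pred[n] i)
  (λ i → Fin.fromℕ<-toℕ i _) (λ (j , p) → ≤-pair (Fin.toℕ-fromℕ< (s≤s p)))

triangle↔Fin : ∀ r → Triangle r ↔ Fin (triangle r)
triangle↔Fin zero    = mk↔ₛ′ (λ { (_ , ()) }) (λ ()) (λ ()) (λ { (_ , ()) })
triangle↔Fin (suc r) = ↔-trans first-row (↔-trans (initial↔Fin r ⊎-↔ triangle↔Fin r) (↔-sym Fin.+↔⊎))
  where
  first-row : Triangle (suc r) ↔ ((Σ ℕ λ j → j ≤ r) ⊎ Triangle r)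
  first-row = mk↔ₛ′
    (λ { ((zero , j) , s≤s p) → inj₁ (j , p) ; ((suc i , j) , s≤s p) → inj₂ ((i , j) , p) })
    (λ { (inj₁ (j , p)) → (zero , j) , s≤s p ; (inj₂ ((i , j) , p)) → (suc i , j) , s≤s p })
    (λ { (inj₁ _) → refl ; (inj₂ _) → refl })
    (λ { ((zero , j) , s≤s p) → refl ; ((suc i , j) , s≤s p) → refl })

-- Serves twice: it bounds the order of a labelled tree, and it gives the exact order of the hairy
-- spiders.
labels↔Fin : ∀ {B : Set} {b} k r → B ↔ Fin b → Labels B k r ↔ Fin (b * suc r + k * triangle r)
labels↔Fin {B} k r B↔ = ↔-trans parts
  (↔-trans (↔-trans (B↔ ×-↔ initial↔Fin r) (↔-sym Fin.*↔×)
            ⊎-↔ ↔-trans (↔-refl ×-↔ triangle↔Fin r) (↔-sym Fin.*↔×))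
           (↔-sym Fin.+↔⊎))
  where
  parts : Labels B k r ↔ ((B × (Σ ℕ λ j → j ≤ r)) ⊎ (Fin k × Triangle r))
  parts = mk↔ₛ′
    (λ { (trunk b j , p) → inj₁ (b , j , p) ; (branch c i j , p) → inj₂ (c , (i , j) , p) })
    (λ { (inj₁ (b , j , p)) → trunk b j , p ; (inj₂ (c , (i , j) , p)) → branch c i j , p })
    (λ { (inj₁ _) → refl ; (inj₂ _) → refl })
    (λ { (trunk _ _ , _) → refl ; (branch _ _ _ , _) → refl })

-- Hairy spiders as forests of labels.

even↔labels : ∀ k r → HSEvenV k r ↔ Labels ⊤ k r
even↔labels k r = mk↔ₛ′ to from
  (λ { (trunk tt zero , z≤n) → refl ; (trunk tt (suc j) , p) → refl ; (branch c i j , p) → refl })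
  (λ { root → refl ; (leg c (suc i) j (s≤s z≤n) p) → refl ; (spine (suc i) (s≤s z≤n) p) → refl })
  where
  to : HSEvenV k r → Labels ⊤ k r
  to root                  = trunk tt 0 , z≤n
  to (leg c (suc i) j _ p) = branch c i j , p
  to (spine i _ p)         = trunk tt i , p
  from : Labels ⊤ k r → HSEvenV k r
  from (trunk tt zero , _)    = root
  from (trunk tt (suc j) , p) = spine (suc j) (s≤s z≤n) p
  from (branch c i j , p)     = leg c (suc i) j (s≤s z≤n) p

odd↔labels : ∀ k r → HSOddV k r ↔ Labels Bool k r
odd↔labels k r = mk↔ₛ′ to from
  (λ { (trunk b zero , z≤n) → refl ; (trunk b (suc j) , p) → refl ; (branch c i j , p) → refl })
  (λ { (centre b) → refl ; (leg c (suc i) j (s≤s z≤n) p) → refl ; (spine b (suc i) (s≤s z≤n) p) → refl })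
  where
  to : HSOddV k r → Labels Bool k r
  to (centre b)            = trunk b 0 , z≤n
  to (leg c (suc i) j _ p) = branch c i j , p
  to (spine b i _ p)       = trunk b i , p
  from : Labels Bool k r → HSOddV k r
  from (trunk b zero , _)    = centre b
  from (trunk b (suc j) , p) = spine b (suc j) (s≤s z≤n) p
  from (branch c i j , p)    = leg c (suc i) j (s≤s z≤n) p

evenLabel : ∀ {k r} → HSEvenV k r → Label ⊤ k
evenLabel z = proj₁ (Inverse.to (even↔labels _ _) z)

oddLabel : ∀ {k r} → HSOddV k r → Label Bool k
oddLabel z = proj₁ (Inverse.to (odd↔labels _ _) z)

-- All edges of `HSEvenE` are oriented away from the root, so they are exactly the parent-child
-- pairs of labels.
even-edge : ∀ {k r} (z z' : HSEvenV k r) →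
  HSEvenE k r z z' ⇔
    (∃[ l ] (height (evenLabel z') ≡ suc l × parentLabel (λ _ → tt) (evenLabel z') ≡ evenLabel z))
even-edge {k} {r} z z' = mk⇔ (to z z') (from z z')
  where
  to : ∀ z z' → HSEvenE k r z z' →
       ∃[ l ] (height (evenLabel z') ≡ suc l × parentLabel (λ _ → tt) (evenLabel z') ≡ evenLabel z)
  to root (leg c .1 .0 p q) root-leg = _ , refl , refl
  to (leg c (suc i) 0 p q) (leg .c .(suc (suc i)) .0 p' q') leg-down = _ , refl , refl
  to (leg c (suc i) j p q) (leg .c .(suc i) (suc .j) p' q') leg-hair = _ , refl , refl
  to root (spine .1 p q) root-spine = _ , refl , refl
  to (spine (suc i) p q) (spine .(suc (suc i)) p' q') spine-step = _ , refl , refl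
  from : ∀ z z' → ∃[ l ] (height (evenLabel z') ≡ suc l × parentLabel (λ _ → tt) (evenLabel z') ≡ evenLabel z) →
         HSEvenE k r z z'
  from z root (_ , () , _)
  from root (leg c 1 0 p q) (_ , _ , refl) = root-leg
  from (leg c (suc i) j p q) (leg c' 1 0 p' q') (_ , _ , ())
  from (spine (suc i) p q) (leg c' 1 0 p' q') (_ , _ , ())
  from (leg c (suc i) j p q) (leg c' (suc i') (suc j') p' q') (_ , _ , refl) = leg-hair
  from (leg c (suc i) j p q) (leg c' (suc (suc i')) zero p' q') (_ , _ , refl) = leg-down
  from root (leg c' (suc (suc i')) zero p' q') (_ , _ , ())
  from root (leg c' (suc i') (suc j') p' q') (_ , _ , ())
  from (spine _ _ _) (leg c' (suc (suc i')) zero p' q') (_ , _ , ())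
  from (spine _ _ _) (leg c' (suc i') (suc j') p' q') (_ , _ , ())
  from root (spine 1 p' q') (_ , _ , refl) = root-spine
  from (spine i p q) (spine (suc i') p' q') (_ , _ , refl) = spine-step
  from (leg c (suc i) j p q) (spine (suc i') p' q') (_ , _ , ())

even-adjacent : ∀ {k r} (z z' : HSEvenV k r) →
  Adj (HS-even k r) z z' ⇔ Linked (labelForest (λ _ → tt)) (evenLabel z) (evenLabel z')
even-adjacent {k} z z' = mk⇔
  (λ { (inj₁ e) → inj₁ (Equivalence.to (even-edge z z') e)
     ; (inj₂ e) → inj₂ (inj₁ (Equivalence.to (even-edge z' z) e)) })
  (λ { (inj₁ h) → inj₁ (Equivalence.from (even-edge z z') h)
     ; (inj₂ (inj₁ h)) → inj₂ (Equivalence.from (even-edge z' z) h)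
     ; (inj₂ (inj₂ h)) → contradiction h (roots (evenLabel z) (evenLabel z')) })
  where
  roots : (ℓ ℓ' : Label ⊤ k) → ¬ (height ℓ ≡ 0 × height ℓ' ≡ 0 × ℓ ≢ ℓ')
  roots (trunk _ _) (trunk _ _) (refl , refl , ≢) = ≢ refl

legSide : ∀ {k} → ℕ → Fin k → Bool
legSide a c = toℕ c <ᵇ a

legSide-true : ∀ {k} a {c : Fin k} → legSide a c ≡ true → toℕ c < a
legSide-true a {c} eq = <ᵇ⇒< (toℕ c) a (subst T (≡-sym eq) tt)

legSide-false : ∀ {k} a {c : Fin k} → legSide a c ≡ false → a ≤ toℕ c
legSide-false a eq = ≮⇒≥ λ lt → subst T eq (<⇒<ᵇ lt)

odd-adjacent : ∀ {k r a} (z z' : HSOddV k r) →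
  Adj (HS-odd k r a) z z' ⇔ Linked (labelForest (legSide a)) (oddLabel z) (oddLabel z')
odd-adjacent {k} {r} {a} z z' = mk⇔
  (λ { (inj₁ e) → to z z' e ; (inj₂ e) → swap {z'} {z} (to z' z e) })
  (λ { (inj₁ h) → inj₁ (from z z' h)
     ; (inj₂ (inj₁ h)) → inj₂ (from z' z h)
     ; (inj₂ (inj₂ h)) → roots z z' h })
  where
  F : Forest (Label Bool k)
  F = labelForest (legSide a)
  Parent : HSOddV k r → HSOddV k r → Set
  Parent z z' = ∃[ l ] (height (oddLabel z') ≡ suc l × parentLabel (legSide a) (oddLabel z') ≡ oddLabel z)
  swap : ∀ {z z'} → Linked F (oddLabel z) (oddLabel z') → Linked F (oddLabel z') (oddLabel z)
  swap (inj₁ h)                   = inj₂ (inj₁ h)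
  swap (inj₂ (inj₁ h))            = inj₁ h
  swap (inj₂ (inj₂ (e , e' , ≢))) = inj₂ (inj₂ (e' , e , λ eq → ≢ (≡-sym eq)))
  to : ∀ z z' → HSOddE k r a z z' → Linked F (oddLabel z) (oddLabel z')
  to _ _ u-w = inj₂ (inj₂ (refl , refl , λ ()))
  -- The decision `toℕ c <? a` computes to the Boolean `legSide a c`, so `dec-true` and `dec-false`
  -- evaluate the side.
  to _ (leg c .1 .0 p q) (u-leg lt) =
    inj₁ (_ , refl , cong (λ b → trunk b 0) (dec-true (toℕ c <? a) lt))
  to _ (leg c .1 .0 p q) (w-leg ge) =
    inj₁ (_ , refl , cong (λ b → trunk b 0) (dec-false (toℕ c <? a) (≤⇒≯ ge)))
  to (leg c (suc i) 0 p q) (leg .c .(suc (suc i)) .0 p' q') leg-down = inj₁ (_ , refl , refl)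
  to (leg c (suc i) j p q) (leg .c .(suc i) (suc .j) p' q') leg-hair = inj₁ (_ , refl , refl)
  to (centre b) (spine .b .1 p q) root-spine = inj₁ (_ , refl , refl)
  to (spine b (suc i) p q) (spine .b .(suc (suc i)) p' q') spine-step = inj₁ (_ , refl , refl)
  trunk-inj : ∀ {b b' : Bool} → trunk {k = k} b 0 ≡ trunk b' 0 → b ≡ b'
  trunk-inj refl = refl
  from : ∀ z z' → Parent z z' → HSOddE k r a z z'
  from z (centre _) (_ , () , _)
  from (centre true) (leg c 1 0 p q) (_ , _ , eq) = u-leg (legSide-true a (trunk-inj eq))
  from (centre false) (leg c 1 0 p q) (_ , _ , eq) = w-leg (legSide-false a (trunk-inj eq))
  from (leg c (suc i) j p q) (leg c' 1 0 p' q') (_ , _ , ())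
  from (spine _ (suc i) p q) (leg c' 1 0 p' q') (_ , _ , ())
  from (leg c (suc i) j p q) (leg c' (suc i') (suc j') p' q') (_ , _ , refl) = leg-hair
  from (leg c (suc i) j p q) (leg c' (suc (suc i')) zero p' q') (_ , _ , refl) = leg-down
  from (centre _) (leg c' (suc (suc i')) zero p' q') (_ , _ , ())
  from (centre _) (leg c' (suc i') (suc j') p' q') (_ , _ , ())
  from (spine _ _ _ _) (leg c' (suc (suc i')) zero p' q') (_ , _ , ())
  from (spine _ _ _ _) (leg c' (suc i') (suc j') p' q') (_ , _ , ())
  from (centre _) (spine _ 1 p' q') (_ , _ , refl) = root-spine
  from (spine _ i p q) (spine _ (suc i') p' q') (_ , _ , refl) = spine-step
  from (leg c (suc i) j p q) (spine _ (suc i') p' q') (_ , _ , ())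
  roots : ∀ z z' → height (oddLabel z) ≡ 0 × height (oddLabel z') ≡ 0 × oddLabel z ≢ oddLabel z' →
          Adj (HS-odd k r a) z z'
  roots (centre true)  (centre true)  (_ , _ , ≢) = contradiction refl ≢
  roots (centre true)  (centre false) _ = inj₁ u-w
  roots (centre false) (centre true)  _ = inj₂ u-w
  roots (centre false) (centre false) (_ , _ , ≢) = contradiction refl ≢
  roots (leg _ (suc _) _ _ _) _ (() , _)
  roots (spine _ (suc _) _ _) _ (() , _)
  roots (centre _) (leg _ (suc _) _ _ _) (_ , () , _)
  roots (centre _) (spine _ (suc _) _ _) (_ , () , _)

-- The labelling of a forest, and the case where it is onto.

-- Pigeonhole: punching out a missed value would embed `Fin (suc n)` into `Fin n`.
injective⇒surjective : ∀ {n m} → n ≡ m → (f : Fin n → Fin m) → (∀ {x y} → f x ≡ f y → x ≡ y) →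
                       ∀ z → ∃[ x ] f x ≡ z
injective⇒surjective {suc n} refl f inj z with Fin.any? (λ x → f x Fin.≟ z)
... | yes found = found
... | no missed = contradiction
  (Fin.injective⇒≤ {f = λ x → punchOut (avoids x)}
    (λ {x} {y} eq → inj (Fin.punchOut-injective (avoids x) (avoids y) eq)))
  1+n≰n
  where
  avoids : ∀ x → z ≢ f x
  avoids x eq = missed (x , ≡-sym eq)


-- Applied with `B = ⊤` to the whole tree and with `B = Bool` to the tree cut at its central edge.
-- The resolving set enters only through its listing `e` and `free-child-unique`.
module Labelling {n k : ℕ} {B : Set} (F : Forest (Fin n)) (r : ℕ)
  (level-bound : ∀ x → Forest.level F x ≤ r)
  (root : Fin n → B)
  (root-parent : ∀ {x l} → Forest.level F x ≡ suc l → root (Forest.parent F x) ≡ root x)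
  (root-injective : ∀ {x y} → Forest.level F x ≡ 0 → Forest.level F y ≡ 0 → root x ≡ root y → x ≡ y)
  (e : Fin k → Fin n)
  (free-child-unique : ∀ {x y l l'} → Forest.level F x ≡ suc l → Forest.level F y ≡ suc l' →
     Forest.parent F x ≡ Forest.parent F y →
     (∀ i → ¬ Descent.Below F x (e i)) → (∀ i → ¬ Descent.Below F y (e i)) → x ≡ y)
  {b : ℕ} (B↔ : B ↔ Fin b)
  where
  open Forest F
  open Descent F

  chosen : Fin n → Maybe (Fin k)
  chosen y with Fin.any? (λ i → below? Fin._≟_ y (e i))
  ... | yes (i , _) = just i
  ... | no _        = nothing

  chosen-just : ∀ {y i} → chosen y ≡ just i → Below y (e i)
  chosen-just {y} eq with Fin.any? (λ i → below? Fin._≟_ y (e i))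
  chosen-just refl | yes (_ , b) = b

  chosen-nothing : ∀ {y} → chosen y ≡ nothing → ∀ i → ¬ Below y (e i)
  chosen-nothing {y} eq i b with Fin.any? (λ i → below? Fin._≟_ y (e i))
  ... | no none = none (i , b)

  -- A relation, so that a vertex with a prescribed label can be analysed by cases; the recursion of
  -- `hasLabel` runs on the level instead. A leg vertex of level `suc l` receives `branch i l 0`,
  -- whose height is again `suc l`.
  data HasLabel : Fin n → Label B k → Set where
    at-root : ∀ {y} → level y ≡ 0 → HasLabel y (trunk (root y) 0)
    at-leg  : ∀ {y l i} → level y ≡ suc l → chosen y ≡ just i → HasLabel y (branch i l 0)
    at-free : ∀ {y l ℓ} → level y ≡ suc l → chosen y ≡ nothing → HasLabel (parent y) ℓ →
              HasLabel y (extend ℓ)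

  hasLabel : ∀ y → ∃[ ℓ ] HasLabel y ℓ
  hasLabel y = go (level y) y refl
    where
    go : ∀ l y → level y ≡ l → ∃[ ℓ ] HasLabel y ℓ
    go zero    y eq = _ , at-root eq
    go (suc l) y eq with chosen y in ch
    ... | just i  = _ , at-leg eq ch
    ... | nothing with ℓ , h ← go l (parent y) (level-parent eq) = _ , at-free eq ch h

  label : Fin n → Label B k
  label y = proj₁ (hasLabel y)

  label-level : ∀ {y ℓ} → HasLabel y ℓ → height ℓ ≡ level y
  label-level (at-root eq) = ≡-sym eq
  label-level (at-leg eq _) = trans (cong suc (+-identityʳ _)) (≡-sym eq)
  label-level (at-free {ℓ = ℓ} eq _ h) =
    trans (height-extend ℓ) (trans (cong suc (trans (label-level h) (level-parent eq))) (≡-sym eq))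

  -- Equal leg labels belong to two ancestors of the same `e i` at one level. Equal free labels give
  -- equal parents by induction, and a parent has at most one free child. The equation is a separate
  -- argument because `extend` is a function, against which indices cannot be unified.
  hasLabel-injective : ∀ {y y' ℓ ℓ'} → HasLabel y ℓ → HasLabel y' ℓ' → ℓ ≡ ℓ' → y ≡ y'
  hasLabel-injective (at-root eq) (at-root eq') q = root-injective eq eq' (trunk-inj q)
    where
    trunk-inj : ∀ {b b' : B} {i j} → trunk {k = k} b i ≡ trunk b' j → b ≡ b'
    trunk-inj refl = refl
  hasLabel-injective (at-root _) (at-leg _ _) ()
  hasLabel-injective (at-leg _ _) (at-root _) ()
  hasLabel-injective (at-root _) (at-free {ℓ = ℓ} _ _ _) q = contradiction (≡-sym q) (extend≢trunk ℓ)
  hasLabel-injective (at-free {ℓ = ℓ} _ _ _) (at-root _) q = contradiction q (extend≢trunk ℓ)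
  hasLabel-injective (at-leg eq ch) (at-leg eq' ch') refl =
    below-unique (trans eq (≡-sym eq')) (chosen-just ch) (chosen-just ch')
  hasLabel-injective (at-leg _ _) (at-free {ℓ = ℓ} _ _ _) q = contradiction (≡-sym q) (extend≢branch ℓ)
  hasLabel-injective (at-free {ℓ = ℓ} _ _ _) (at-leg _ _) q = contradiction q (extend≢branch ℓ)
  hasLabel-injective (at-free eq ch h) (at-free eq' ch' h') q =
    free-child-unique eq eq' (hasLabel-injective h h' (extend-injective q))
      (chosen-nothing ch) (chosen-nothing ch')

  label-injective : ∀ {x y} → label x ≡ label y → x ≡ y
  label-injective {x} {y} = hasLabel-injective (proj₂ (hasLabel x)) (proj₂ (hasLabel y))

  hasLabel-unique : ∀ {y ℓ ℓ'} → HasLabel y ℓ → HasLabel y ℓ' → ℓ ≡ ℓ'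
  hasLabel-unique (at-root _) (at-root _) = refl
  hasLabel-unique (at-root e) (at-leg e' _) with () ← trans (≡-sym e) e'
  hasLabel-unique (at-root e) (at-free e' _ _) with () ← trans (≡-sym e) e'
  hasLabel-unique (at-leg e' _) (at-root e) with () ← trans (≡-sym e) e'
  hasLabel-unique (at-free e' _ _) (at-root e) with () ← trans (≡-sym e) e'
  hasLabel-unique (at-leg e c) (at-leg e' c') with refl ← trans (≡-sym e) e' | refl ← trans (≡-sym c) c' = refl
  hasLabel-unique (at-leg _ c) (at-free _ c' _) with () ← trans (≡-sym c) c'
  hasLabel-unique (at-free _ c' _) (at-leg _ c) with () ← trans (≡-sym c) c'
  hasLabel-unique (at-free _ _ h) (at-free _ _ h') = cong extend (hasLabel-unique h h')

  trunk-0 : ∀ {y b} → HasLabel y (trunk b 0) → level y ≡ 0 × root y ≡ b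
  trunk-0 h = go h refl
    where
    go : ∀ {y b ℓ} → HasLabel y ℓ → ℓ ≡ trunk b 0 → level y ≡ 0 × root y ≡ b
    go (at-root eq) refl = eq , refl
    go (at-free {ℓ = ℓ} _ _ _) q = contradiction q (extend≢trunk ℓ)

  -- In the odd case this free child of a root competes with the opposite end of the central edge.
  trunk-1 : ∀ {y b} → HasLabel y (trunk b 1) →
            (level (parent y) ≡ 0 × root (parent y) ≡ b) × level y ≡ 1 × (∀ i → ¬ Below y (e i))
  trunk-1 h = go h refl
    where
    go : ∀ {y b ℓ} → HasLabel y ℓ → ℓ ≡ trunk b 1 →
         (level (parent y) ≡ 0 × root (parent y) ≡ b) × level y ≡ 1 × (∀ i → ¬ Below y (e i))
    go (at-free {ℓ = trunk b zero} eq ch h) refl =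
      trunk-0 h , trans (≡-sym (label-level (at-free eq ch h))) refl , chosen-nothing ch

  -- The guard `1 ≤ r` leaves `side` free when `r = 0`: no leg has a vertex then.
  module _ (side : Fin k → B) (side-root : 1 ≤ r → ∀ i → root (e i) ≡ side i)
           (surjective : ∀ ℓ → height ℓ ≤ r → ∃[ y ] (HasLabel y ℓ)) where

    private
      parent-branch : ∀ {y y' l i} → level y ≡ suc l → Below y (e i) → level (parent y) ≡ level y' →
                      Below y' (e i) → y' ≡ parent y
      parent-branch eq b lev b' = below-unique (≡-sym lev) b' (parent-below eq b)

    -- Surjectivity forces the choice of leg to be compatible with taking parents.
    hasLabel-parent : ∀ {y l ℓ} → level y ≡ suc l → HasLabel y ℓ → HasLabel (parent y) (parentLabel side ℓ)
    hasLabel-parent eq (at-root eq') with () ← trans (≡-sym eq) eq'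
    hasLabel-parent _ (at-free {ℓ = ℓ} _ _ h) =
      subst (HasLabel _) (≡-sym (parentLabel-extend side ℓ)) h
    hasLabel-parent {y} _ (at-leg {l = zero} {i} eq ch) =
      subst (λ b → HasLabel (parent y) (trunk b 0)) same (at-root (level-parent eq))
      where
      same : root (parent y) ≡ side i
      same = trans (root-parent eq)
        (trans (below-invariant root root-parent (chosen-just ch))
               (side-root (≤-trans (s≤s z≤n) (≤-trans (≤-reflexive (≡-sym eq)) (level-bound y))) i))
    hasLabel-parent {y} _ (at-leg {l = suc l} {i} eq ch) =
      go (proj₂ found) refl
      where
      -- The bearer of this label is an ancestor of `e i` at the level of `parent y`. So is
      -- `parent y` itself, hence the two coincide and `parent y` must have chosen `i` as well.
      found : ∃[ y' ] HasLabel y' (branch i l 0)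
      found = surjective (branch i l 0)
        (≤-trans (≤-trans (≤-reflexive (cong suc (+-identityʳ l)))
           (≤-trans (n≤1+n _) (≤-reflexive (≡-sym eq)))) (level-bound y))
      go : ∀ {y' ℓ} → HasLabel y' ℓ → ℓ ≡ branch i l 0 → HasLabel (parent y) (branch i l 0)
      go h@(at-leg eq' ch') refl =
        subst (λ z → HasLabel z _)
          (parent-branch eq (chosen-just ch) (trans (level-parent eq) (≡-sym eq')) (chosen-just ch')) h
      go (at-free {ℓ = ℓ} _ _ _) q = contradiction q (extend≢branch ℓ)

    label-parent : ∀ {y l} → level y ≡ suc l → parentLabel side (label y) ≡ label (parent y)
    label-parent eq = hasLabel-unique (hasLabel-parent eq (proj₂ (hasLabel _))) (proj₂ (hasLabel _))

    label-linked : ∀ {x y} → Linked F x y ⇔ Linked (labelForest side) (label x) (label y)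
    label-linked = linked-cong F (labelForest side) label label-injective
      (λ x → label-level (proj₂ (hasLabel x))) label-parent

  bounded-label : Fin n → Labels B k r
  bounded-label y = label y ,
    ≤-trans (≤-reflexive (label-level (proj₂ (hasLabel y)))) (level-bound y)

  private
    order : ℕ
    order = b * suc r + k * triangle r
    index : Labels B k r ↔ Fin order
    index = labels↔Fin k r B↔
    code : Fin n → Fin order
    code y = Inverse.to index (bounded-label y)

  code-injective : ∀ {x y} → code x ≡ code y → x ≡ y
  code-injective eq = label-injective (cong proj₁ (Injection.injective (↔⇒↣ index) eq))

  order-bound : n ≤ order
  order-bound = Fin.injective⇒≤ code-injective

  module _ (full : n ≡ order) where

    bounded-label-onto : ∀ ℓ → ∃[ y ] bounded-label y ≡ ℓ
    bounded-label-onto ℓ with y , eq ← injective⇒surjective full code code-injective (Inverse.to index ℓ) =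
      y , Injection.injective (↔⇒↣ index) eq

    label-onto : ∀ ℓ → height ℓ ≤ r → ∃[ y ] HasLabel y ℓ
    label-onto ℓ le = proj₁ onto ,
      subst (HasLabel (proj₁ onto)) (cong proj₁ (proj₂ onto)) (proj₂ (hasLabel (proj₁ onto)))
      where
      onto : ∃[ y ] bounded-label y ≡ (ℓ , le)
      onto = bounded-label-onto (ℓ , le)

    vertex↔label : Fin n ↔ Labels B k r
    vertex↔label = mk↔ₛ′ bounded-label (λ ℓ → proj₁ (bounded-label-onto ℓ))
      (λ ℓ → proj₂ (bounded-label-onto ℓ))
      (λ y → label-injective (cong proj₁ (proj₂ (bounded-label-onto (bounded-label y)))))

    isomorphic : {T : Graph (Fin n)} → (∀ {x y} → Adj T x y ⇔ Linked F x y) →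
      (side : Fin k → B) → (1 ≤ r → ∀ i → root (e i) ≡ side i) →
      {W : Set} {H : Graph W} (W↔ : W ↔ Labels B k r) →
      (∀ z z' → Adj H z z' ⇔
         Linked (labelForest side) (proj₁ (Inverse.to W↔ z)) (proj₁ (Inverse.to W↔ z'))) →
      Iso T H
    isomorphic T-adj side side-root {H = H} W↔ H-adj = ↔-trans vertex↔label (↔-sym W↔) , λ x y →
      ⇔-sym (H-adj _ _) ⇔-∘ (relabel x y ⇔-∘ (label-linked side side-root label-onto ⇔-∘ T-adj))
      where
      relabel : ∀ x y → Linked (labelForest side) (label x) (label y) ⇔
        Linked (labelForest side)
          (proj₁ (Inverse.to W↔ (Inverse.from W↔ (bounded-label x))))
          (proj₁ (Inverse.to W↔ (Inverse.from W↔ (bounded-label y))))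
      relabel x y = subst₂ (λ ℓ ℓ' → Linked (labelForest side) (label x) (label y) ⇔
                                     Linked (labelForest side) (proj₁ ℓ) (proj₁ ℓ'))
        (≡-sym (Inverse.strictlyInverseˡ W↔ (bounded-label x)))
        (≡-sym (Inverse.strictlyInverseˡ W↔ (bounded-label y))) (⇔-id _)

-- Listing a resolving set by sides.

record Partition {n} (R : Subset n) (s : Fin n → Bool) : Set where
  field
    {size₁ size₂} : ℕ
    e₁      : Fin size₁ → Fin n
    e₂      : Fin size₂ → Fin n
    size    : size₁ + size₂ ≡ ∣ R ∣
    e₁-true : ∀ i → s (e₁ i) ≡ true
    e₂-false : ∀ i → s (e₂ i) ≡ false
    covers  : ∀ {x} → x ∈ R → (∃[ i ] e₁ i ≡ x) ⊎ (∃[ i ] e₂ i ≡ x)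

partition : ∀ {n} (R : Subset n) (s : Fin n → Bool) → Partition R s
partition [] s = record
  { size₁ = 0 ; size₂ = 0 ; e₁ = λ () ; e₂ = λ () ; size = refl
  ; e₁-true = λ () ; e₂-false = λ () ; covers = λ () }
partition (b ∷ R) s = add b (s fzero) refl
  where
  open Partition (partition R (λ i → s (fsuc i)))
  shift : ∀ {m} {f : Fin m → _} {x} → ∃[ i ] f i ≡ x → ∃[ i ] fsuc (f i) ≡ fsuc x
  shift (i , eq) = i , cong fsuc eq
  add : ∀ b c → s fzero ≡ c → Partition (b ∷ R) s
  add false _ _ = record
    { e₁ = λ i → fsuc (e₁ i) ; e₂ = λ i → fsuc (e₂ i)
    ; size = size ; e₁-true = e₁-true ; e₂-false = e₂-false
    ; covers = λ { (there x∈) → Sum.map shift shift (covers x∈) } }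
  add true true s0 = record
    { e₁ = λ { fzero → fzero ; (fsuc i) → fsuc (e₁ i) } ; e₂ = λ i → fsuc (e₂ i)
    ; size = cong suc size
    ; e₁-true = λ { fzero → s0 ; (fsuc i) → e₁-true i } ; e₂-false = e₂-false
    ; covers = λ { here → inj₁ (fzero , refl)
                 ; (there x∈) → Sum.map (λ (i , eq) → fsuc i , cong fsuc eq) shift (covers x∈) } }
  add true false s0 = record
    { e₁ = λ i → fsuc (e₁ i) ; e₂ = λ { fzero → fzero ; (fsuc i) → fsuc (e₂ i) }
    ; size = trans (+-suc size₁ size₂) (cong suc size)
    ; e₁-true = e₁-true ; e₂-false = λ { fzero → s0 ; (fsuc i) → e₂-false i }
    ; covers = λ { here → inj₂ (fzero , refl)
                 ; (there x∈) → Sum.map shift (λ (i , eq) → fsuc i , cong fsuc eq) (covers x∈) } }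

-- The odd hairy spider hangs exactly the legs with index below a at `centre true`. Listing the
-- elements on side `true` first matches this convention, and `cut` becomes the parameter a.
record SortedListing {n} (R : Subset n) (s : Fin n → Bool) (k : ℕ) : Set where
  field
    cut    : ℕ
    e      : Fin k → Fin n
    sorted : ∀ i → s (e i) ≡ legSide cut i
    covers : ∀ {x} → x ∈ R → ∃[ i ] e i ≡ x

sortedListing : ∀ {n} (R : Subset n) (s : Fin n → Bool) {k} → ∣ R ∣ ≡ k → SortedListing R s k
sortedListing R s refl with partition R s
... | P rewrite ≡-sym (Partition.size P) = record
  { cut = size₁ ; e = e ; sorted = sorted ; covers = λ x∈ → cover (covers x∈) }
  where
  open Partition P
  e : Fin (size₁ + size₂) → _
  e i = Sum.[ e₁ , e₂ ]′ (splitAt size₁ i)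
  sorted : ∀ i → s (e i) ≡ legSide size₁ i
  sorted i with toℕ i <? size₁
  ... | yes lt rewrite Fin.splitAt-< size₁ i lt = trans (e₁-true _) (≡-sym (dec-true (toℕ i <? size₁) lt))
  ... | no  ge rewrite Fin.splitAt-≥ size₁ i (≮⇒≥ ge) =
    trans (e₂-false _) (≡-sym (dec-false (toℕ i <? size₁) ge))
  cover : ∀ {x} → (∃[ i ] e₁ i ≡ x) ⊎ (∃[ i ] e₂ i ≡ x) → ∃[ i ] e i ≡ x
  cover (inj₁ (i , eq)) = i ↑ˡ size₂ , trans (cong Sum.[ e₁ , e₂ ]′ (Fin.splitAt-↑ˡ size₁ i size₂)) eq
  cover (inj₂ (i , eq)) = size₁ ↑ʳ i , trans (cong Sum.[ e₁ , e₂ ]′ (Fin.splitAt-↑ʳ size₁ size₂ i)) eq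

-- Depth bounds from the diameter, and free siblings.

module RootedAtCentre {n : ℕ} (T : Graph (Fin n)) (tree : IsTree T) (c : Fin n)
  {d : ℕ} (diameter : ∀ u v m → Dist T u v m → m ≤ d) where
  open RootedTree T tree c public

  suc-depth≰0 : ∀ {x l} → depth x ≡ suc l → x ≢ c
  suc-depth≰0 eq refl = 0≢1+n (trans (≡-sym depth-root) eq)

  ancestor-1 : ∀ {x l} → depth x ≡ suc l → ∃[ b ] (depth b ≡ 1 × Below b x)
  ancestor-1 {x} {zero}  eq = x , eq , here
  ancestor-1 {x} {suc l} eq with b , d1 , below ← ancestor-1 {parent x} (proj₂ (depth-suc eq)) =
    b , d1 , up eq below

  parent-1 : ∀ {b} → depth b ≡ 1 → parent b ≡ c
  parent-1 eq = depth-0 (proj₂ (depth-suc eq))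

  ¬below-root : ∀ {b l} → depth b ≡ suc l → ¬ Below b c
  ¬below-root eq below =
    1+n≰n (≤-trans (≤-trans (s≤s z≤n) (≤-reflexive (≡-sym eq)))
                   (≤-trans (below-level below) (≤-reflexive depth-root)))

  -- A shortest walk from `x` to `y` crosses the edge above `b`, and its two pieces have lengths at
  -- least `s` and `t`. Deciding the inequality first allows the use of a shortest walk that exists
  -- only under double negation.
  crossing-bound : ∀ {b x y s t} → ¬ Below b x → Below b y →
                   (∀ {m} → Walk T x (parent b) m → s ≤ m) → (∀ {m} → Walk T b y m → t ≤ m) →
                   s + suc t ≤ d
  crossing-bound {x = x} {y} {s} {t} ¬x y-below far far' with s + suc t ≤? d
  ... | yes le = le
  ... | no nle = contradiction absurd (dist-nonempty (proj₂ (proj₁ tree x y)))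
    where
    absurd : ∀ a → ¬ Dist T x y a
    absurd a D@(p , _) with m₁ , m₂ , p₁ , p₂ , eq ← walk-enter ¬x y-below p =
      nle (≤-trans (+-mono-≤ (far p₁) (s≤s (far' p₂))) (≤-trans (≤-reflexive eq) (diameter x y a D)))

  walk-from-child : ∀ {b y m} → depth b ≡ 1 → Walk T b y m → depth y ∸ 1 ≤ m
  walk-from-child {m = m} eq p = ≤-trans
    (∸-monoˡ-≤ 1 (≤-trans (walk-depth p) (≤-reflexive (cong (m +_) eq))))
    (≤-reflexive (m+n∸n≡m m 1))

  walk-to-root : ∀ {y m} → Walk T y c m → depth y ≤ m
  walk-to-root {m = m} p = ≤-trans (walk-depth (reverse p))
    (≤-reflexive (trans (cong (m +_) depth-root) (+-identityʳ m)))

module _ {n k : ℕ} {T : Graph (Fin n)} (tree : IsTree T) (c : Fin n)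
         {R : Subset n} (resolving : Resolving T R)
         {e : Fin k → Fin n} (covers : ∀ {x} → x ∈ R → ∃[ i ] e i ≡ x) where
  open RootedTree T tree c

  free-siblings : ∀ {x y l l'} → depth x ≡ suc l → depth y ≡ suc l' → parent x ≡ parent y →
                  (∀ i → ¬ Below x (e i)) → (∀ i → ¬ Below y (e i)) → x ≡ y
  free-siblings {x} {y} ex ey eq fx fy =
    twins (proj₁ tree) resolving (Graph.sym T (proj₁ (depth-suc ex)))
      (subst (λ v → Adj T v y) (≡-sym eq) (Graph.sym T (proj₁ (depth-suc ey))))
      (λ z∈ → through-parent (avoid fx (covers z∈)))
      (λ {z} z∈ → subst (Through z y) (≡-sym eq) (through-parent (avoid fy (covers z∈))))
    where
    avoid : ∀ {x z} → (∀ i → ¬ Below x (e i)) → ∃[ i ] e i ≡ z → ¬ Below x z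
    avoid f (i , refl) = f i

-- Even diameter: the tree rooted at its central vertex.

module EvenTree {n r : ℕ} (T : Graph (Fin n)) (tree : IsTree T)
  (diameter : ∀ u v m → Dist T u v m → m ≤ r + r)
  {u c v : Fin n} (p : Walk T u c r) (q : Walk T c v r)
  (geodesic : ∀ m → Walk T u v m → r + r ≤ m) where
  open RootedAtCentre T tree c diameter public

  u-far : ∀ {m} → Walk T u c m → r ≤ m
  u-far {m} p' = +-cancelʳ-≤ r r m (geodesic _ (p' ⊕ q))

  v-far : ∀ {m} → Walk T v c m → r ≤ m
  v-far {m} q' = +-cancelˡ-≤ r r m (geodesic _ (p ⊕ reverse q'))

  -- Otherwise both halves of the diametral path pass through `b`, and omitting the detour to `c`
  -- shortens it.
  ¬both-below : ∀ {b} → depth b ≡ 1 → Below b u → ¬ Below b v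
  ¬both-below d1 bu bv
    with i₁ , i₂ , _ , p₂ , refl ← walk-enter (¬below-root d1) bu (reverse p)
       | j₁ , j₂ , _ , q₂ , eq ← walk-enter (¬below-root d1) bv q =
    1+n≰n (≤-trans (+-mono-≤ (m≤n+m (suc i₂) i₁)
                      (≤-trans (≤-trans (n≤1+n j₂) (m≤n+m (suc j₂) j₁)) (≤-reflexive eq)))
                   (geodesic _ (reverse p₂ ⊕ q₂)))

  -- At least one of `u` and `v` lies outside the branch at `c` that contains `y`. Walks from that
  -- end to `y` pass `c`, so their length is at least `r + depth y`, while the diameter is `r + r`.
  depth-bound : ∀ y → depth y ≤ r
  depth-bound y = bound (depth y) refl
    where
    within : ∀ {b z} → depth b ≡ 1 → Below b y → ¬ Below b z → (∀ {m} → Walk T z c m → r ≤ m) →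
             depth y ≤ r
    within {b} {z} d1 by ¬z far = ≤-trans (m≤n+m∸n (depth y) 1)
      (+-cancelˡ-≤ r _ _ (crossing-bound ¬z by
        (λ w → far (subst (λ t → Walk T z t _) (parent-1 d1) w)) (walk-from-child d1)))
    bound : ∀ l → depth y ≡ l → depth y ≤ r
    bound zero    eq = ≤-trans (≤-reflexive eq) z≤n
    bound (suc l) eq with b , d1 , by ← ancestor-1 eq with below? Fin._≟_ b u
    ... | no ¬u  = within d1 by ¬u u-far
    ... | yes bu = within d1 by (¬both-below d1 bu) v-far

  tree-adjacent : ∀ {x y} → Adj T x y ⇔ Linked forest x y
  tree-adjacent {x} {y} = mk⇔ to from
    where
    to : Adj T x y → Linked forest x y
    to e with adjacent e
    ... | inj₁ (d , eq) = inj₁ (_ , d , eq)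
    ... | inj₂ (d , eq) = inj₂ (inj₁ (_ , d , eq))
    from : Linked forest x y → Adj T x y
    from (inj₁ (_ , d , refl))        = Graph.sym T (proj₁ (depth-suc d))
    from (inj₂ (inj₁ (_ , d , refl))) = proj₁ (depth-suc d)
    from (inj₂ (inj₂ (dx , dy , ≢)))  = contradiction (trans (depth-0 dx) (≡-sym (depth-0 dy))) ≢

  module EvenExtremal {k : ℕ} {R : Subset n} (resolving : Resolving T R)
           {e : Fin k → Fin n} (covers : ∀ {x} → x ∈ R → ∃[ i ] e i ≡ x) where

    open Labelling forest r depth-bound (λ _ → tt) (λ _ → refl)
      (λ ex ey _ → trans (depth-0 ex) (≡-sym (depth-0 ey))) e
      (free-siblings tree c resolving covers) (↔-sym Fin.1↔⊤) public

    hairy-spider : n ≡ 1 * suc r + k * triangle r → Iso T (HS-even k r)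
    hairy-spider full =
      isomorphic full {T = T} tree-adjacent (λ _ → tt) (λ _ _ → refl) {H = HS-even k r} (even↔labels k r) even-adjacent

-- Odd diameter: the tree cut at its central edge.

-- Rooting at the end `c` of the central edge makes `w` a child of the root, so `Below w` decides in
-- which half a vertex lies.
module OddTree {n r : ℕ} (T : Graph (Fin n)) (tree : IsTree T)
  (diameter : ∀ u v m → Dist T u v m → m ≤ r + suc r)
  {u c w v : Fin n} (p : Walk T u c r) (c-w : Adj T c w) (q : Walk T w v r)
  (geodesic : ∀ m → Walk T u v m → r + suc r ≤ m) where
  open RootedAtCentre T tree c diameter public

  child-w : depth w ≡ 1 × parent w ≡ c
  child-w with adjacent c-w
  ... | inj₁ (d , eq) = trans d (cong suc depth-root) , eq
  ... | inj₂ (d , _)  = contradiction refl (suc-depth≰0 d)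

  depth-w : depth w ≡ 1
  depth-w = proj₁ child-w

  parent-w : parent w ≡ c
  parent-w = proj₂ child-w

  -- Otherwise `p` already passes `w`, and continuing from there along `q` beats the diametral path.
  -- For `v-inside` the shortcut is the mirror image: `q` would pass `c`.
  u-outside : ¬ Below w u
  u-outside wu with i₁ , i₂ , _ , p₂ , refl ← walk-enter (¬below-root depth-w) wu (reverse p) =
    1+n≰n (≤-trans (+-cancelʳ-≤ r _ _ (≤-trans (≤-reflexive (≡-sym (+-suc r r))) (geodesic _ (reverse p₂ ⊕ q))))
            (≤-trans (n≤1+n i₂) (m≤n+m (suc i₂) i₁)))

  v-inside : Below w v
  v-inside with below? Fin._≟_ w v
  ... | yes wv = wv
  ... | no ¬wv with i₁ , i₂ , p₁ , _ , refl ← walk-enter ¬wv here (reverse q) =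
    contradiction (≤-trans (+-cancelˡ-≤ r _ _ (geodesic _ (p ⊕ reverse (subst (λ z → Walk T v z i₁) parent-w p₁))))
                    (m≤m+n i₁ (suc i₂))) 1+n≰n

  u-far : ∀ {m} → Walk T u (parent w) m → r ≤ m
  u-far {m} p' = +-cancelʳ-≤ (suc r) r m
    (geodesic _ (subst (λ z → Walk T u z m) parent-w p' ⊕ cons c-w q))

  v-far : ∀ {m} → Walk T w v m → r ≤ m
  v-far {m} q' = ≤-pred (+-cancelˡ-≤ r (suc r) (suc m) (geodesic _ (p ⊕ cons c-w q')))

  -- Each half is measured against the diametral end in the other half: crossing to the opposite
  -- root costs `suc r`, out of the diameter `r + suc r`.
  inside-bound : ∀ {y} → Below w y → depth y ∸ 1 ≤ r
  inside-bound wy = ≤-pred (+-cancelˡ-≤ r _ _ (crossing-bound u-outside wy u-far (walk-from-child depth-w)))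

  outside-bound : ∀ {y} → ¬ Below w y → depth y ≤ r
  outside-bound {y} ¬wy = +-cancelʳ-≤ (suc r) _ _
    (crossing-bound ¬wy v-inside (λ {m} p' → walk-to-root (subst (λ z → Walk T y z m) parent-w p')) v-far)

  -- Cutting the central edge c–w leaves two trees, rooted at c and at w.
  cutLevel : Fin n → ℕ
  cutLevel y with below? Fin._≟_ w y
  ... | yes _ = depth y ∸ 1
  ... | no _  = depth y

  inside-level : ∀ {y} → Below w y → cutLevel y ≡ depth y ∸ 1
  inside-level {y} b with below? Fin._≟_ w y
  ... | yes _ = refl
  ... | no ¬b = contradiction b ¬b

  outside-level : ∀ {y} → ¬ Below w y → cutLevel y ≡ depth y
  outside-level {y} ¬b with below? Fin._≟_ w y
  ... | yes b = contradiction b ¬b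
  ... | no _  = refl

  cutRoot : Fin n → Bool
  cutRoot y = not (does (below? Fin._≟_ w y))

  inside-root : ∀ {y} → Below w y → cutRoot y ≡ false
  inside-root {y} b = cong not (dec-true (below? Fin._≟_ w y) b)

  outside-root : ∀ {y} → ¬ Below w y → cutRoot y ≡ true
  outside-root {y} ¬b = cong not (dec-false (below? Fin._≟_ w y) ¬b)

  root-inside : ∀ {y} → cutRoot y ≡ false → Below w y
  root-inside {y} eq with below? Fin._≟_ w y
  root-inside _  | yes b = b
  root-inside () | no _

  root-outside : ∀ {y} → cutRoot y ≡ true → ¬ Below w y
  root-outside eq b with () ← trans (≡-sym eq) (inside-root b)

  cutLevel-bound : ∀ y → cutLevel y ≤ r
  cutLevel-bound y with below? Fin._≟_ w y
  ... | yes b = inside-bound b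
  ... | no ¬b = outside-bound ¬b

  inside-parent : ∀ {y l} → cutLevel y ≡ suc l → Below w y → Below w (parent y) × depth y ≡ suc (suc l)
  inside-parent {y} {l} eq b = below-parent deep w≢y b , deep
    where
    deep : depth y ≡ suc (suc l)
    deep with depth y | trans (≡-sym (inside-level b)) eq
    ... | suc _ | refl = refl
    w≢y : w ≢ y
    w≢y refl with () ← trans (≡-sym depth-w) deep

  outside-parent : ∀ {y l} → cutLevel y ≡ suc l → ¬ Below w y → ¬ Below w (parent y) × depth y ≡ suc l
  outside-parent eq ¬b = (λ b → ¬b (up deep b)) , deep
    where
    deep : depth _ ≡ suc _
    deep = trans (≡-sym (outside-level ¬b)) eq

  cutLevel-suc : ∀ {y l} → cutLevel y ≡ suc l → ∃[ l' ] depth y ≡ suc l'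
  cutLevel-suc {y} eq with below? Fin._≟_ w y in wy
  ... | no _  = _ , eq
  ... | yes b = _ , proj₂ (inside-parent (trans (inside-level b) eq) b)

  cutLevel-parent : ∀ {y l} → cutLevel y ≡ suc l → cutLevel (parent y) ≡ l
  cutLevel-parent {y} eq = go (below? Fin._≟_ w y)
    where
    go : Dec (Below w y) → cutLevel (parent y) ≡ _
    go (yes b) with b' , deep ← inside-parent eq b =
      trans (inside-level b') (cong (_∸ 1) (proj₂ (depth-suc deep)))
    go (no ¬b) with ¬b' , deep ← outside-parent eq ¬b =
      trans (outside-level ¬b') (proj₂ (depth-suc deep))

  cutForest : Forest (Fin n)
  cutForest = record { parent = parent ; level = cutLevel ; level-parent = cutLevel-parent }

  cutRoot-parent : ∀ {y l} → cutLevel y ≡ suc l → cutRoot (parent y) ≡ cutRoot y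
  cutRoot-parent {y} eq = go (below? Fin._≟_ w y)
    where
    go : Dec (Below w y) → cutRoot (parent y) ≡ cutRoot y
    go (yes b) = trans (inside-root (proj₁ (inside-parent eq b))) (≡-sym (inside-root b))
    go (no ¬b) = trans (outside-root (proj₁ (outside-parent eq ¬b))) (≡-sym (outside-root ¬b))

  cutLevel-w : cutLevel w ≡ 0
  cutLevel-w = trans (inside-level here) (cong (_∸ 1) depth-w)

  cutLevel-c : cutLevel c ≡ 0
  cutLevel-c = trans (outside-level (¬below-root depth-w)) depth-root

  c≢w : c ≢ w
  c≢w refl = irrefl T c-w

  cutLevel-0 : ∀ {y} → cutLevel y ≡ 0 → (cutRoot y ≡ true × y ≡ c) ⊎ (cutRoot y ≡ false × y ≡ w)
  cutLevel-0 {y} eq = go (below? Fin._≟_ w y)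
    where
    go : Dec (Below w y) → _
    go (no ¬b) = inj₁ (outside-root ¬b , depth-0 (trans (≡-sym (outside-level ¬b)) eq))
    go (yes b) = inj₂ (inside-root b , ≡-sym (below-unique (trans depth-w (≡-sym depth-1)) b here))
      where
      depth-1 : depth y ≡ 1
      depth-1 = ≤-antisym (m∸n≡0⇒m≤n (trans (≡-sym (inside-level b)) eq))
        (≤-trans (≤-reflexive (≡-sym depth-w)) (below-level b))

  cutRoot-injective : ∀ {x y} → cutLevel x ≡ 0 → cutLevel y ≡ 0 → cutRoot x ≡ cutRoot y → x ≡ y
  cutRoot-injective ex ey eq with cutLevel-0 ex | cutLevel-0 ey
  ... | inj₁ (_ , refl) | inj₁ (_ , refl) = refl
  ... | inj₂ (_ , refl) | inj₂ (_ , refl) = refl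
  ... | inj₁ (t , _) | inj₂ (f , _) with () ← trans (≡-sym t) (trans eq f)
  cutRoot-injective ex ey eq | inj₂ (f , _) | inj₁ (t , _) with () ← trans (≡-sym f) (trans eq t)

  -- A climb in the tree leaves the cut forest only by the step from `w` to `c`, and `c` lies below
  -- no vertex of positive depth. So the climb to `y` never takes that step.
  below⇒cutBelow : ∀ {y x l} → cutLevel y ≡ suc l → Below y x → Descent.Below cutForest y x
  below⇒cutBelow _ here = Descent.here
  below⇒cutBelow {y} {x} ey (up d b) with cutLevel x in ex
  ... | suc _ = Descent.up ex (below⇒cutBelow ey b)
  ... | zero with cutLevel-0 ex
  ...   | inj₁ (_ , x≡c)  = contradiction x≡c (suc-depth≰0 d)
  ...   | inj₂ (_ , refl) =
    contradiction (subst (Below y) parent-w b) (¬below-root (proj₂ (cutLevel-suc ey)))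

  cut-adjacent : ∀ {x y} → Adj T x y ⇔ Linked cutForest x y
  cut-adjacent = mk⇔ to from
    where
    child : ∀ {x y} → ChildOf x y →
            (∃[ l ] (cutLevel y ≡ suc l × parent y ≡ x)) ⊎ (x ≡ c × y ≡ w)
    child {x} {y} (d , refl) with cutLevel y in ey
    ... | suc _ = inj₁ (_ , refl , refl)
    ... | zero with cutLevel-0 ey
    ...   | inj₁ (_ , y≡c)  = contradiction y≡c (suc-depth≰0 d)
    ...   | inj₂ (_ , refl) = inj₂ (parent-w , refl)
    to : ∀ {x y} → Adj T x y → Linked cutForest x y
    to e with adjacent e
    to e | inj₁ h with child h
    ... | inj₁ h'            = inj₁ h'
    ... | inj₂ (refl , refl) = inj₂ (inj₂ (cutLevel-c , cutLevel-w , c≢w))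
    to e | inj₂ h with child h
    ... | inj₁ h'            = inj₂ (inj₁ h')
    ... | inj₂ (refl , refl) = inj₂ (inj₂ (cutLevel-w , cutLevel-c , λ eq → c≢w (≡-sym eq)))
    up-edge : ∀ {y l} → cutLevel y ≡ suc l → Adj T y (parent y)
    up-edge eq = proj₁ (depth-suc (proj₂ (cutLevel-suc eq)))
    from : ∀ {x y} → Linked cutForest x y → Adj T x y
    from (inj₁ (_ , d , refl))        = Graph.sym T (up-edge d)
    from (inj₂ (inj₁ (_ , d , refl))) = up-edge d
    from (inj₂ (inj₂ (dx , dy , ≢))) with cutLevel-0 dx | cutLevel-0 dy
    ... | inj₁ (_ , refl) | inj₁ (_ , refl) = contradiction refl ≢
    ... | inj₁ (_ , refl) | inj₂ (_ , refl) = c-w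
    ... | inj₂ (_ , refl) | inj₁ (_ , refl) = Graph.sym T c-w
    ... | inj₂ (_ , refl) | inj₂ (_ , refl) = contradiction refl ≢

  module _ {k : ℕ} {R : Subset n} (resolving : Resolving T R)
           {e : Fin k → Fin n} (covers : ∀ {x} → x ∈ R → ∃[ i ] e i ≡ x) where

    cut-free-siblings : ∀ {x y l l'} → cutLevel x ≡ suc l → cutLevel y ≡ suc l' → parent x ≡ parent y →
      (∀ i → ¬ Descent.Below cutForest x (e i)) → (∀ i → ¬ Descent.Below cutForest y (e i)) → x ≡ y
    cut-free-siblings ex ey eq fx fy =
      free-siblings tree c resolving covers (proj₂ (cutLevel-suc ex)) (proj₂ (cutLevel-suc ey)) eq
        (λ i b → fx i (below⇒cutBelow ex b)) (λ i b → fy i (below⇒cutBelow ey b))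

    -- A free child y of c (of w) together with an end of c–w whose side avoids R are twins.
    some-inside : ∀ {y} → cutLevel (parent y) ≡ 0 → cutRoot (parent y) ≡ true → cutLevel y ≡ 1 →
                  (∀ i → ¬ Descent.Below cutForest y (e i)) → ¬ (∀ i → cutRoot (e i) ≡ true)
    some-inside {y} py ry ey free outside with cutLevel-0 py
    ... | inj₂ (f , _) with () ← trans (≡-sym ry) f
    some-inside {y} py ry ey free outside | inj₁ (_ , eq) =
      contradiction (trans (≡-sym cutLevel-w) (trans (cong cutLevel w≡y) ey)) 0≢1+n
      where
      w≡y : w ≡ y
      w≡y = free-siblings tree c resolving covers depth-w (proj₂ (cutLevel-suc ey)) (trans parent-w (≡-sym eq))
        (λ i → root-outside (outside i)) (λ i b → free i (below⇒cutBelow ey b))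

    some-outside : ∀ {y} → cutLevel (parent y) ≡ 0 → cutRoot (parent y) ≡ false → cutLevel y ≡ 1 →
                   (∀ i → ¬ Descent.Below cutForest y (e i)) → ¬ (∀ i → cutRoot (e i) ≡ false)
    some-outside {y} py ry ey free inside with cutLevel-0 py
    ... | inj₁ (t , _) with () ← trans (≡-sym ry) t
    some-outside {y} py ry ey free inside | inj₂ (_ , eq) =
      contradiction (trans (≡-sym cutLevel-c) (trans (cong cutLevel c≡y) ey)) 0≢1+n
      where
      w-y : Adj T w y
      w-y = subst (λ z → Adj T z y) eq (Graph.sym T (proj₁ (depth-suc (proj₂ (cutLevel-suc ey)))))
      through-w : ∀ {x} → ∃[ i ] e i ≡ x → Through {G = T} x c w
      through-w {x} (i , refl) =
        subst (λ z → Through x z w) parent-w (through-child depth-w (root-inside (inside i)))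
      through-y : ∀ {x} → ∃[ i ] e i ≡ x → Through {G = T} x y w
      through-y {x} (i , refl) =
        subst (λ z → Through x y z) eq (through-parent (λ b → free i (below⇒cutBelow ey b)))
      -- Here `c` is the parent of `w`, not a sibling of `y`, so `twins` is applied directly at `w`:
      -- elements of `R` below `w` reach `c` only through `w`.
      c≡y : c ≡ y
      c≡y = twins (proj₁ tree) resolving (Graph.sym T c-w) w-y
        (λ x∈ → through-w (covers x∈)) (λ x∈ → through-y (covers x∈))

    module OddExtremal (cut : ℕ) (sorted : ∀ i → cutRoot (e i) ≡ legSide cut i) where

      open Labelling cutForest r cutLevel-bound cutRoot cutRoot-parent cutRoot-injective e
        cut-free-siblings (↔-sym Fin.2↔Bool) public

      hairy-spider : n ≡ 2 * suc r + k * triangle r →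
        ∀ a → (1 ≤ r → ∀ i → cutRoot (e i) ≡ legSide a i) → Iso T (HS-odd k r a)
      hairy-spider full a same =
        isomorphic full {T = T} cut-adjacent (legSide a) same {H = HS-odd k r a} (odd↔labels k r) odd-adjacent

      free-true : ∀ {y} → HasLabel y (trunk true 1) → ¬ (∀ i → cutRoot (e i) ≡ true)
      free-true h = some-inside (proj₁ (proj₁ t)) (proj₂ (proj₁ t)) (proj₁ (proj₂ t)) (proj₂ (proj₂ t))
        where t = trunk-1 h

      free-false : ∀ {y} → HasLabel y (trunk false 1) → ¬ (∀ i → cutRoot (e i) ≡ false)
      free-false h = some-outside (proj₁ (proj₁ t)) (proj₂ (proj₁ t)) (proj₁ (proj₂ t)) (proj₂ (proj₂ t))
        where t = trunk-1 h

      -- With `cut = 0` all of `R` would lie in the half of `w`, while surjectivity puts a vertex at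
      -- `trunk false 1`; `1 ≤ r` is what admits this label.
      0<cut : n ≡ 2 * suc r + k * triangle r → 1 ≤ r → 0 < cut
      0<cut full 1≤r = ≮⇒≥ λ cut<1 → free-false (proj₂ (label-onto full (trunk false 1) 1≤r))
        (λ i → trans (sorted i) (dec-false (toℕ i <? cut) (λ lt → <⇒≱ lt (≤-trans (≤-pred cut<1) z≤n))))

      cut<k : n ≡ 2 * suc r + k * triangle r → 1 ≤ r → cut < k
      cut<k full 1≤r = ≰⇒> λ k≤cut → free-true (proj₂ (label-onto full (trunk true 1) 1≤r))
        (λ i → trans (sorted i) (dec-true (toℕ i <? cut) (<-≤-trans (Fin.toℕ<n i) k≤cut)))

      extremal : 2 ≤ k → n ≡ 2 * suc r + k * triangle r → Dec (1 ≤ r) →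
                 ∃[ a ] (0 < a × a < k × Iso T (HS-odd k r a))
      extremal _   full (yes 1≤r) = cut , 0<cut full 1≤r , cut<k full 1≤r , hairy-spider full cut (λ _ → sorted)
      -- For `r = 0` every parameter gives the same single edge, and `2≤k` makes 1 an admissible
      -- value.
      extremal 2≤k full (no 1≰r)  = 1 , ≤-refl , 2≤k , hairy-spider full 1 (λ 1≤r → contradiction 1≤r 1≰r)

-- The two parities assembled, and the arithmetic of the bounds.

even-case : ∀ {n r k} (T : Graph (Fin n)) → IsTree T → Diameter T (r + r) →
  {R : Subset n} → Resolving T R → ∣ R ∣ ≡ k →
  n ≤ 1 * suc r + k * triangle r × (n ≡ 1 * suc r + k * triangle r → Iso T (HS-even k r))
even-case {r = r} {k} T tree ((u , v , path , geodesic) , diameter) {R} resolving size =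
  go (splitWalk r path) (sortedListing R (λ _ → true) size)
  where
  go : ∃[ c ] (Walk T u c r × Walk T c v r) → SortedListing R (λ _ → true) k → _
  go (c , p , q) listing = order-bound , hairy-spider
    where open EvenTree.EvenExtremal T tree diameter p q geodesic resolving (SortedListing.covers listing)

odd-case : ∀ {n r k} (T : Graph (Fin n)) → IsTree T → Diameter T (r + suc r) →
  {R : Subset n} → Resolving T R → ∣ R ∣ ≡ k → 2 ≤ k →
  n ≤ 2 * suc r + k * triangle r ×
  (n ≡ 2 * suc r + k * triangle r → ∃[ a ] (0 < a × a < k × Iso T (HS-odd k r a)))
odd-case {r = r} {k} T tree ((u , v , path , geodesic) , diameter) {R} resolving size 2≤k =
  go (splitWalk r path)
  where
  go : ∃[ c ] (Walk T u c r × Walk T c v (suc r)) → _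
  -- Splitting `r + suc r` after `r` steps makes the first edge of the second piece the central
  -- edge.
  go (c , p , cons c-w q) = order-bound , λ full → extremal 2≤k full (1 ≤? r)
    where
    open OddTree T tree diameter p c-w q geodesic using (cutRoot)
    listing : SortedListing R cutRoot k
    listing = sortedListing R cutRoot size
    open OddTree.OddExtremal T tree diameter p c-w q geodesic resolving
      (SortedListing.covers listing) (SortedListing.cut listing) (SortedListing.sorted listing)

2*triangle : ∀ r → 2 * triangle r ≡ r * suc r
2*triangle zero    = refl
2*triangle (suc r) = trans (*-distribˡ-+ 2 (suc r) (triangle r))
  (trans (cong (2 * suc r +_) (2*triangle r)) (solve 1 (λ r → con 2 :* (con 1 :+ r) :+ r :* (con 1 :+ r)
    := (con 1 :+ r) :* (con 2 :+ r)) refl r))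

-- Only the double of `triangle r` is a polynomial over the naturals, so a factor 2 of the 8 goes to
-- it. Moving another 2 to `suc r` yields the factor d+2 for d = 2r and d+1 for d = 2r+1.
8*order : ∀ b k r → 8 * (b * suc r + k * triangle r) ≡ (8 * b + 4 * k * r) * suc r
8*order b k r = trans
  (solve 4 (λ b k r t → con 8 :* (b :* (con 1 :+ r) :+ k :* t)
    := con 8 :* b :* (con 1 :+ r) :+ con 4 :* k :* (con 2 :* t)) refl b k r (triangle r))
  (trans (cong (λ t → 8 * b * suc r + 4 * k * t) (2*triangle r))
    (solve 3 (λ b k r → con 8 :* b :* (con 1 :+ r) :+ con 4 :* k :* (r :* (con 1 :+ r))
      := (con 8 :* b :+ con 4 :* k :* r) :* (con 1 :+ r)) refl b k r))

even-order : ∀ k r → 8 * (1 * suc r + k * triangle r) ≡ (k * (2 * r) + 4) * (2 * r + 2)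
even-order k r = trans (8*order 1 k r)
  (solve 2 (λ k r → (con 8 :+ con 4 :* k :* r) :* (con 1 :+ r)
    := (k :* (con 2 :* r) :+ con 4) :* (con 2 :* r :+ con 2)) refl k r)

odd-order : ∀ k r → 8 * (2 * suc r + k * triangle r) ≡ (k * (2 * r + 1) ∸ k + 8) * (2 * r + 1 + 1)
odd-order k r = trans (8*order 2 k r) (trans
  (solve 2 (λ k r → (con 16 :+ con 4 :* k :* r) :* (con 1 :+ r)
    := (k :* (con 2 :* r) :+ con 8) :* (con 2 :* r :+ con 1 :+ con 1)) refl k r)
  -- The truncated subtraction is exact, since `k * (2 * r + 1)` is `k * (2 * r) + k`.
  (cong (λ t → (t + 8) * (2 * r + 1 + 1)) (≡-sym
    (trans (cong (_∸ k) (trans (*-distribˡ-+ k (2 * r) 1) (cong (k * (2 * r) +_) (*-identityʳ k))))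
           (m+n∸n≡m (k * (2 * r)) k)))))

scaled-bound : ∀ {n N M} {P : Set} → 8 * N ≡ M → n ≤ N × (n ≡ N → P) → (P → n ≡ N) →
               8 * n ≤ M × (8 * n ≡ M ⇔ P)
scaled-bound {n} {N} refl (bound , equality⇒) ⇒equality =
  *-monoʳ-≤ 8 bound , mk⇔ (λ eq → equality⇒ (*-cancelˡ-≡ n N 8 eq)) (λ p → cong (8 *_) (⇒equality p))

theorem1 : ∀ (n : ℕ) (T : Graph (Fin n)) (d k : ℕ) →
    IsTree T → Diameter T d → MetricDim T k → 2 ≤ k →
    (∀ r → d ≡ 2 * r →
    (8 * n ≤ (k * d + 4) * (d + 2))
    × ((8 * n ≡ (k * d + 4) * (d + 2)) ⇔ Iso T (HS-even k r)))
    × (∀ r → d ≡ 2 * r + 1 →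
    (8 * n ≤ (k * d ∸ k + 8) * (d + 1))
    × ((8 * n ≡ (k * d ∸ k + 8) * (d + 1))
    ⇔ (∃[ a ] (0 < a × a < k × Iso T (HS-odd k r a)))))
theorem1 n T d k tree diameter ((R , resolving , size) , _) 2≤k =
  (λ { r refl → scaled-bound (even-order k r)
         (even-case T tree (subst (Diameter T) (2*-even r) diameter) resolving size)
         -- For the converse, the vertex bijection of an isomorphism already fixes `n` as the number
         -- of labels.
         (λ (f , _) → ↔⇒≡ (↔-trans f (↔-trans (even↔labels k r) (labels↔Fin k r (↔-sym Fin.1↔⊤))))) }) ,
  (λ { r refl → scaled-bound (odd-order k r)
         (odd-case T tree (subst (Diameter T) (2*-odd r) diameter) resolving size 2≤k)
         (λ (_ , _ , _ , f , _) →
            ↔⇒≡ (↔-trans f (↔-trans (odd↔labels k r) (labels↔Fin k r (↔-sym Fin.2↔Bool))))) })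
  where
  2*-even : ∀ r → 2 * r ≡ r + r
  2*-even r = cong (r +_) (+-identityʳ r)
  2*-odd : ∀ r → 2 * r + 1 ≡ r + suc r
  2*-odd r = trans (+-comm (2 * r) 1) (trans (cong suc (2*-even r)) (≡-sym (+-suc r r)))
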